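{- Let $K$ be a commutative $\mathbb Q$-algebra, $n\ge1$, and let $F=X-H$ be a polynomial map over $K$ in $n$ variables having symmetric Jacobian matrix, with $H=(H_1,\ldots,H_n)$ homogeneous of degree $2$ and $(JH)^4=0$. Then $F$ is invertible with $$F^{ -1}=X+N^{(1)}+N^{(2)}+N^{(3)}+N^{(4)}.$$ In particular, the degree of $F^{ -1}$ is $\le 5$.
   Context: $X=(X_1,\ldots,X_n)$, and $JH=(D_iH_j)$ with $D_i=\partial/\partial X_i$. "Homogeneous of degree $2$" means each $H_i\in K[X_1,\ldots,X_n]$ is homogeneous of degree $2$ (possibly zero). "Invertible" means that $F$ has an inverse under composition which is a polynomial map over $K$. Such an $F=X-H$ always has a unique formal inverse $G$ (a system of power series $G_i=X_i+\text{higher degree terms}$ with $F\circ G=G\circ F=X$), and when $H$ is homogeneous of degree $d=2$ it has the form $G=X+N^{(1)}+N^{(2)}+N^{(3)}+\cdots$ with $N^{(m)}$ (an $n$-tuple) homogeneous of degree $m(d-1)+1=m+1$; this defines the $N^{(m)}$. -}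

module Defs where

open import Algebra.Bundles using (CommutativeRing)
open import Algebra.Morphism.Structures using (module RingMorphisms)
import Algebra.Properties.Monoid.Sum as MonoidSum
import Algebra.Properties.Ring as RingProperties
open import Data.Bool using (if_then_else_)
open import Data.Fin using (Fin; zero; suc; toℕ; _≟_)
open import Data.Fin.Properties using (toℕ≤pred[n])
open import Data.List using (List; []; _∷_; length) renaming (_++_ to _++ᴸ_)
open import Data.List.Properties using (length-++)
open import Data.Nat as ℕ using (ℕ; zero; suc; _∸_)
open import Data.Nat.Properties using (m+[n∸m]≡n)
open import Data.Product using (_×_; _,_)
open import Data.Rational using (ℚ)
import Data.Rational.Properties as ℚ
open import Data.Vec.Functional using (Vector)
open import Level using (Level; _⊔_) renaming (suc to lsuc)
open import Relation.Binary using (IsEquivalence)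
open import Relation.Binary.PropositionalEquality
  using (_≡_; refl; cong₂; trans; subst)
open import Relation.Nullary.Decidable using (⌊_⌋)

record Commutativeℚ-Algebra (c ℓ : Level) : Set (lsuc (c ⊔ ℓ)) where
  field
    commutativeRing : CommutativeRing c ℓ
  open CommutativeRing commutativeRing using (Carrier; rawRing)
  open RingMorphisms ℚ.+-*-rawRing rawRing using (IsRingHomomorphism)
  field
    structureMap       : ℚ → Carrier
    isRingHomomorphism : IsRingHomomorphism structureMap

module Polynomials {c ℓ : Level} (K : CommutativeRing c ℓ) where

  private module K = CommutativeRing K

  infix  8 -_
  infixl 7 _*_
  infixl 6 _+_
  infix  4 _≈_

  -- K[X₁,…,Xₙ], constructed as the free commutative K-algebra on n generators:
  -- terms modulo the least congruence _≈_ that satisfies the commutative ring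
  -- axioms and makes `con` a ring homomorphism.

  data Poly (n : ℕ) : Set c where
    con     : K.Carrier → Poly n
    var     : Fin n → Poly n
    _+_ _*_ : Poly n → Poly n → Poly n
    -_      : Poly n → Poly n

  0# 1# : ∀ {n} → Poly n
  0# = con K.0#
  1# = con K.1#

  data _≈_ {n : ℕ} : Poly n → Poly n → Set (c ⊔ ℓ) where
    ≈-refl  : ∀ {p} → p ≈ p
    ≈-sym   : ∀ {p q} → p ≈ q → q ≈ p
    ≈-trans : ∀ {p q r} → p ≈ q → q ≈ r → p ≈ r

    +-cong : ∀ {p p′ q q′} → p ≈ p′ → q ≈ q′ → p + q ≈ p′ + q′
    *-cong : ∀ {p p′ q q′} → p ≈ p′ → q ≈ q′ → p * q ≈ p′ * q′
    neg-cong : ∀ {p p′} → p ≈ p′ → - p ≈ - p′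

    +-assoc     : ∀ p q r → (p + q) + r ≈ p + (q + r)
    +-comm      : ∀ p q → p + q ≈ q + p
    +-identityˡ : ∀ p → 0# + p ≈ p
    +-inverseˡ  : ∀ p → (- p) + p ≈ 0#
    *-assoc     : ∀ p q r → (p * q) * r ≈ p * (q * r)
    *-comm      : ∀ p q → p * q ≈ q * p
    *-identityˡ : ∀ p → 1# * p ≈ p
    *-distribʳ  : ∀ p q r → (q + r) * p ≈ (q * p) + (r * p)

    con-cong : ∀ {a b} → a K.≈ b → con a ≈ con b
    con-+    : ∀ a b → con (a K.+ b) ≈ con a + con b
    con-*    : ∀ a b → con (a K.* b) ≈ con a * con b

  polyRing : ℕ → CommutativeRing c (c ⊔ ℓ)
  polyRing n = record
    { Carrier = Poly n
    ; _≈_ = _≈_ ; _+_ = _+_ ; _*_ = _*_ ; -_ = -_ ; 0# = 0# ; 1# = 1#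
    ; isCommutativeRing = record
      { isRing = record
        { +-isAbelianGroup = record
          { isGroup = record
            { isMonoid = record
              { isSemigroup = record
                { isMagma = record
                  { isEquivalence = isEquivalence ; ∙-cong = +-cong }
                ; assoc = +-assoc }
              ; identity = +-identityˡ , +-identityʳ }
            ; inverse = +-inverseˡ , λ p → ≈-trans (+-comm p (- p)) (+-inverseˡ p)
            ; ⁻¹-cong = neg-cong }
          ; comm = +-comm }
        ; *-cong = *-cong
        ; *-assoc = *-assoc
        ; *-identity = *-identityˡ , λ p → ≈-trans (*-comm p 1#) (*-identityˡ p)
        ; distrib = *-distribˡ , *-distribʳ }
      ; *-comm = *-comm } }
    where
    isEquivalence : IsEquivalence _≈_
    isEquivalence = record { refl = ≈-refl ; sym = ≈-sym ; trans = ≈-trans }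
    +-identityʳ : ∀ p → p + 0# ≈ p
    +-identityʳ p = ≈-trans (+-comm p 0#) (+-identityˡ p)
    *-distribˡ : ∀ p q r → p * (q + r) ≈ (p * q) + (p * r)
    *-distribˡ p q r = ≈-trans (*-comm p (q + r))
      (≈-trans (*-distribʳ p q r) (+-cong (*-comm q p) (*-comm r p)))

  ∑ : ∀ {n} m → Vector (Poly n) m → Poly n
  ∑ {n} m = MonoidSum.sum (CommutativeRing.+-monoid (polyRing n)) {m}

  module _ {n : ℕ} where

    -- A monomial is the list of its variables, with multiplicity.

    Monomial : Set
    Monomial = List (Fin n)

    ⟦_⟧ᵐ : Monomial → Poly n
    ⟦ [] ⟧ᵐ    = 1#
    ⟦ i ∷ α ⟧ᵐ = var i * ⟦ α ⟧ᵐ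

    -- Span P p: p is a K-linear combination of monomials satisfying P.

    data Span (P : Monomial → Set) : Poly n → Set (c ⊔ ℓ) where
      zeroˢ : Span P 0#
      termˢ : ∀ a {α} → P α → Span P (con a * ⟦ α ⟧ᵐ)
      plusˢ : ∀ {p q} → Span P p → Span P q → Span P (p + q)
      respˢ : ∀ {p q} → p ≈ q → Span P p → Span P q

    Homogeneous : ℕ → Poly n → Set (c ⊔ ℓ)
    Homogeneous d = Span (λ α → length α ≡ d)

    Degree≤ : ℕ → Poly n → Set (c ⊔ ℓ)
    Degree≤ d = Span (λ α → length α ℕ.≤ d)

    ∂ : Fin n → Poly n → Poly n
    ∂ i (con a) = 0#
    ∂ i (var j) = if ⌊ i ≟ j ⌋ then 1# else 0#
    ∂ i (p + q) = ∂ i p + ∂ i q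
    ∂ i (p * q) = (∂ i p * q) + (p * ∂ i q)
    ∂ i (- p)   = - ∂ i p

    Matrix : Set c
    Matrix = Fin n → Fin n → Poly n

    identityᴹ zeroᴹ : Matrix
    identityᴹ i j = if ⌊ i ≟ j ⌋ then 1# else 0#
    zeroᴹ i j = 0#

    _*ᴹ_ : Matrix → Matrix → Matrix
    (A *ᴹ B) i j = ∑ n (λ k → A i k * B k j)

    _^ᴹ_ : Matrix → ℕ → Matrix
    A ^ᴹ zero  = identityᴹ
    A ^ᴹ suc m = A *ᴹ (A ^ᴹ m)

    infix 4 _≈ᴹ_
    _≈ᴹ_ : Matrix → Matrix → Set (c ⊔ ℓ)
    A ≈ᴹ B = ∀ i j → A i j ≈ B i j

    Symmetric : Matrix → Set (c ⊔ ℓ)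
    Symmetric A = ∀ i j → A i j ≈ A j i

    homogeneous-∑ : ∀ {d} m (f : Vector (Poly n) m) →
                      (∀ k → Homogeneous d (f k)) → Homogeneous d (∑ m f)
    homogeneous-∑ zero    f h = zeroˢ
    homogeneous-∑ (suc m) f h =
      plusˢ (h zero) (homogeneous-∑ m (λ k → f (suc k)) (λ k → h (suc k)))

    private
      module R = CommutativeRing (polyRing n)
      module P = RingProperties R.ring

      ⟦⟧ᵐ-++ : ∀ α β → ⟦ α ⟧ᵐ * ⟦ β ⟧ᵐ ≈ ⟦ α ++ᴸ β ⟧ᵐ
      ⟦⟧ᵐ-++ []      β = *-identityˡ _
      ⟦⟧ᵐ-++ (i ∷ α) β = ≈-trans (*-assoc _ _ _) (*-cong ≈-refl (⟦⟧ᵐ-++ α β))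

      term-* : ∀ a α b β → con (a K.* b) * ⟦ α ++ᴸ β ⟧ᵐ
                           ≈ (con a * ⟦ α ⟧ᵐ) * (con b * ⟦ β ⟧ᵐ)
      term-* a α b β =
        ≈-trans (*-cong (con-* a b) (≈-sym (⟦⟧ᵐ-++ α β)))
        (≈-trans (*-assoc _ _ _)
        (≈-trans (*-cong ≈-refl
          (≈-trans (≈-sym (*-assoc _ _ _))
          (≈-trans (*-cong (*-comm _ _) ≈-refl) (*-assoc _ _ _))))
        (≈-sym (*-assoc _ _ _))))

    homogeneous-* : ∀ {d e p q} → Homogeneous d p → Homogeneous e q →
                    Homogeneous (d ℕ.+ e) (p * q)
    homogeneous-* zeroˢ       k = respˢ (≈-sym (R.zeroˡ _)) zeroˢ
    homogeneous-* (plusˢ h l) k =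
      respˢ (≈-sym (*-distribʳ _ _ _)) (plusˢ (homogeneous-* h k) (homogeneous-* l k))
    homogeneous-* (respˢ e h) k = respˢ (*-cong e ≈-refl) (homogeneous-* h k)
    homogeneous-* (termˢ a p) zeroˢ = respˢ (≈-sym (R.zeroʳ _)) zeroˢ
    homogeneous-* (termˢ a p) (plusˢ h l) = respˢ (≈-sym (R.distribˡ _ _ _))
      (plusˢ (homogeneous-* (termˢ a p) h) (homogeneous-* (termˢ a p) l))
    homogeneous-* (termˢ a p) (respˢ e h) =
      respˢ (*-cong ≈-refl e) (homogeneous-* (termˢ a p) h)
    homogeneous-* (termˢ a {α} p) (termˢ b {β} q) = respˢ (term-* a α b β)
      (termˢ (a K.* b) (trans (length-++ α) (cong₂ ℕ._+_ p q)))

    homogeneous-con : ∀ a → Homogeneous 0 (con a)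
    homogeneous-con a = respˢ (R.*-identityʳ _) (termˢ a {[]} refl)

    homogeneous-var : ∀ i → Homogeneous 1 (var i)
    homogeneous-var i =
      respˢ (≈-trans (*-identityˡ _) (R.*-identityʳ _)) (termˢ K.1# {i ∷ []} refl)

    homogeneous-neg : ∀ {d p} → Homogeneous d p → Homogeneous d (- p)
    homogeneous-neg h =
      respˢ (P.-1*x≈-x _) (homogeneous-* (respˢ con-neg (homogeneous-con (K.- K.1#))) h)
      where
      con-neg : con (K.- K.1#) ≈ - 1#
      con-neg = P.+-inverseˡ-unique _ _
        (≈-trans (≈-sym (con-+ _ _)) (con-cong (K.-‿inverseˡ _)))

  PolyMap : ℕ → Set c
  PolyMap n = Vector (Poly n) n

  infix 4 _≋_
  _≋_ : ∀ {n} → PolyMap n → PolyMap n → Set (c ⊔ ℓ)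
  F ≋ G = ∀ i → F i ≈ G i

  X : ∀ {n} → PolyMap n
  X = var

  infixl 6 _⊕_ _⊖_
  _⊕_ _⊖_ : ∀ {n} → PolyMap n → PolyMap n → PolyMap n
  (F ⊕ G) i = F i + G i
  (F ⊖ G) i = F i + (- G i)

  infixl 9 _[_]
  _[_] : ∀ {m n} → Poly m → Vector (Poly n) m → Poly n
  con a   [ G ] = con a
  var i   [ G ] = G i
  (p + q) [ G ] = p [ G ] + q [ G ]
  (p * q) [ G ] = p [ G ] * q [ G ]
  (- p)   [ G ] = - (p [ G ])

  infixr 9 _∘ᴾ_
  _∘ᴾ_ : ∀ {n} → PolyMap n → PolyMap n → PolyMap n
  (F ∘ᴾ G) i = F i [ G ]

  IsInverse : ∀ {n} → PolyMap n → PolyMap n → Set (c ⊔ ℓ)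
  IsInverse F G = (F ∘ᴾ G ≋ X) × (G ∘ᴾ F ≋ X)

  J : ∀ {n} → PolyMap n → Matrix
  J F i j = ∂ i (F j)

  -- K[[X₁,…,Xₙ]] as the product over d of the modules of homogeneous
  -- polynomials of degree d: a power series is given by its homogeneous parts.

  record PowerSeries (n : ℕ) : Set (c ⊔ ℓ) where
    field
      part        : ℕ → Poly n
      homogeneous : ∀ d → Homogeneous d (part d)

  open PowerSeries public

  infix 4 _≈ˢ_
  _≈ˢ_ : ∀ {n} → PowerSeries n → PowerSeries n → Set (c ⊔ ℓ)
  S ≈ˢ T = ∀ d → part S d ≈ part T d

  conˢ : ∀ {n} → K.Carrier → PowerSeries n
  conˢ a .part zero    = con a
  conˢ a .part (suc _) = 0#
  conˢ a .homogeneous zero    = homogeneous-con a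
  conˢ a .homogeneous (suc _) = zeroˢ

  varˢ : ∀ {n} → Fin n → PowerSeries n
  varˢ i .part 1 = var i
  varˢ i .part _ = 0#
  varˢ i .homogeneous 0             = zeroˢ
  varˢ i .homogeneous 1             = homogeneous-var i
  varˢ i .homogeneous (suc (suc _)) = zeroˢ

  _+ˢ_ _*ˢ_ : ∀ {n} → PowerSeries n → PowerSeries n → PowerSeries n
  (S +ˢ T) .part d = part S d + part T d
  (S +ˢ T) .homogeneous d = plusˢ (homogeneous S d) (homogeneous T d)
  (S *ˢ T) .part d = ∑ (suc d) (λ k → part S (toℕ k) * part T (d ∸ toℕ k))
  (S *ˢ T) .homogeneous d = homogeneous-∑ (suc d) _ λ k →
    subst (λ e → Homogeneous e (part S (toℕ k) * part T (d ∸ toℕ k)))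
      (m+[n∸m]≡n (toℕ≤pred[n] k))
      (homogeneous-* (homogeneous S (toℕ k)) (homogeneous T (d ∸ toℕ k)))

  -ˢ_ : ∀ {n} → PowerSeries n → PowerSeries n
  (-ˢ S) .part d = - part S d
  (-ˢ S) .homogeneous d = homogeneous-neg (homogeneous S d)

  infixl 9 _[_]ˢ
  _[_]ˢ : ∀ {m n} → Poly m → Vector (PowerSeries n) m → PowerSeries n
  con a   [ T ]ˢ = conˢ a
  var i   [ T ]ˢ = T i
  (p + q) [ T ]ˢ = (p [ T ]ˢ) +ˢ (q [ T ]ˢ)
  (p * q) [ T ]ˢ = (p [ T ]ˢ) *ˢ (q [ T ]ˢ)
  (- p)   [ T ]ˢ = -ˢ (p [ T ]ˢ)

  toSeries : ∀ {n} → Poly n → PowerSeries n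
  toSeries p = p [ varˢ ]ˢ

  -- Substitution into a power series, meaningful when no T i has a constant
  -- term: then (part S d) [ T ]ˢ has no parts of degree below d, so the infinite
  -- sum of these series over d reduces to d ≤ e in degree e.

  infixl 9 _⟪_⟫
  _⟪_⟫ : ∀ {m n} → PowerSeries m → Vector (PowerSeries n) m → PowerSeries n
  (S ⟪ T ⟫) .part e = ∑ (suc e) (λ d → part (part S (toℕ d) [ T ]ˢ) e)
  (S ⟪ T ⟫) .homogeneous e = homogeneous-∑ (suc e) _ λ d →
    homogeneous (part S (toℕ d) [ T ]ˢ) e

  record IsFormalInverse {n : ℕ} (F : PolyMap n)
                         (G : Vector (PowerSeries n) n) : Set (c ⊔ ℓ) where
    field
      part₀ : ∀ i → part (G i) 0 ≈ 0#
      part₁ : ∀ i → part (G i) 1 ≈ var i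
      F∘G≈X : ∀ i → F i [ G ]ˢ ≈ˢ varˢ i
      G∘F≈X : ∀ i → G i ⟪ (λ j → toSeries (F j)) ⟫ ≈ˢ varˢ i

  -- N⁽ᵐ⁾, when H is homogeneous of degree 2 and G is the formal inverse of X - H.

  N : ∀ {n} → Vector (PowerSeries n) n → ℕ → PolyMap n
  N G m i = part (G i) (suc m)

-- Put u · v = JH(u) v. As H is quadratic and JH symmetric, this is a commutative
-- bilinear product on K[X]ⁿ for which the dot product is invariant, H(u) = ½ u · u,
-- and every multiplication operator has fourth power zero. Polarising u(u(u(uv))) = 0,
-- and moving factors across the dot product, gives a second family of identities, the
-- polarisations of Σ_{i+j=3} (Lⁱw)(Lʲz) = 0 with L the multiplication by u. These
-- make the subalgebra generated by any x the span of
--   x, a = xx, b = xa, c = xb, d = aa, e = xd, f = xe,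
-- whose only further nonzero products are ac = -f, ad = -2f and bb = 2f. In this
-- algebra over ℚ, G = x + a/2 + b/2 + (c/2 + d/8) + e/8 solves G = x + ½ G · G, and
-- substituting x - a/2 for x in G gives x. Comparing homogeneous parts in
-- G = X + H(G) shows that the formal inverse has the same N⁽¹⁾, …, N⁽⁴⁾.

module Submission where

open import Defs
open import Algebra.Bundles using (CommutativeRing)
open import Algebra.Morphism.Structures using (module RingMorphisms)
import Algebra.Properties.Ring as RingProperties
import Algebra.Properties.Semiring.Sum as Sum
import Algebra.Solver.Ring as RingSolver
open import Algebra.Solver.Ring.AlmostCommutativeRing
  using (fromCommutativeRing; _-Raw-AlmostCommutative⟶_)
open import Data.Bool using (if_then_else_)
open import Data.Fin using (Fin; zero; suc; toℕ; _≟_; #_)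
import Data.Integer as ℤ
open import Data.List as List using (List; []; _∷_)
import Data.Maybe as Maybe
open import Data.Nat as ℕ using (ℕ; zero; suc; _≤_; _∸_)
import Data.Nat.Properties as ℕ
open import Data.Product using (Σ-syntax; _×_; _,_; proj₁; proj₂)
open import Data.Rational as ℚ using (ℚ; 0ℚ; 1ℚ; ½; -½)
import Data.Rational.Properties as ℚ
open import Data.Vec as Vec using (Vec; []; _∷_)
open import Data.Vec.Functional using (Vector)
import Data.Vec.Functional.Relation.Binary.Pointwise.Properties as Functional
open import Data.Vec.Relation.Binary.Pointwise.Inductive using (Pointwise; []; _∷_)
open import Function using (_∘_)
open import Level using (_⊔_)
open import Relation.Binary using (Setoid)
import Relation.Binary.PropositionalEquality as ≡
open ≡ using (_≡_)
import Relation.Binary.Reasoning.Setoid as SetoidReasoning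
open import Relation.Nullary using (contradiction)
open import Relation.Nullary.Decidable using (⌊_⌋; yes; no; True; toWitness; dec⇒maybe)

-- Rational scalars and vectors over a ℚ-algebra.

2ℚ -1ℚ -2ℚ -3ℚ ⅛ ¼ -¾ -⅕ ⅔ -⅔ ¹⁄₁₂ -¹⁄₁₂ -¹⁄₂₄ -⁵⁄₄ : ℚ
2ℚ    = 1ℚ ℚ.+ 1ℚ
-1ℚ   = ℚ.- 1ℚ
-2ℚ   = ℚ.- 2ℚ
-3ℚ   = -1ℚ ℚ.+ -2ℚ
⅛     = ℤ.+ 1 ℚ./ 8
¼     = ℤ.+ 1 ℚ./ 4
-¾    = ℚ.- (ℤ.+ 3 ℚ./ 4)
-⅕    = ℚ.- (ℤ.+ 1 ℚ./ 5)
⅔     = ℤ.+ 2 ℚ./ 3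
-⅔    = ℚ.- ⅔
¹⁄₁₂  = ℤ.+ 1 ℚ./ 12
-¹⁄₁₂ = ℚ.- ¹⁄₁₂
-¹⁄₂₄ = ℚ.- (ℤ.+ 1 ℚ./ 24)
-⁵⁄₄  = ℚ.- (ℤ.+ 5 ℚ./ 4)

module Scalars {c ℓ} (A : Commutativeℚ-Algebra c ℓ) where
  open Commutativeℚ-Algebra A public renaming (structureMap to ι)
  open CommutativeRing commutativeRing public
  open RingMorphisms.IsRingHomomorphism isRingHomomorphism public
    using (+-homo; *-homo; -‿homo; 0#-homo; 1#-homo)
  open RingMorphisms.IsRingHomomorphism isRingHomomorphism using (⟦⟧-cong)

  private
    morphism : ℚ.+-*-rawRing -Raw-AlmostCommutative⟶ fromCommutativeRing commutativeRing
    morphism = record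
      { ⟦_⟧ = ι ; +-homo = +-homo ; *-homo = *-homo ; -‿homo = -‿homo
      ; 0-homo = 0#-homo ; 1-homo = 1#-homo }

  -- The solver's constants are rationals, interpreted by the structure map, so identities with
  -- denominators are settled by normalisation over ℚ.
  open RingSolver ℚ.+-*-rawRing (fromCommutativeRing commutativeRing) morphism
    (λ p q → Maybe.map (λ e → ⟦⟧-cong e) (dec⇒maybe (p ℚ.≟ q))) public
    using (Polynomial; solve; con; _:+_; _:*_; :-_; _:-_; _:=_)

module Vectors {c ℓ} (A : Commutativeℚ-Algebra c ℓ) (n : ℕ) where
  open Scalars A public
  open Sum semiring public using (sum; sum-cong-≋; ∑-distrib-+; ∑-comm; *-distribˡ-sum; *-distribʳ-sum; sum-replicate-zero)

  V : Set c
  V = Vector Carrier n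

  infix  4 _≋_
  infixl 6 _⊞_
  infixr 8 _⋆_

  _≋_ : V → V → Set ℓ
  u ≋ v = ∀ i → u i ≈ v i

  0ⱽ : V
  0ⱽ _ = 0#

  _⊞_ : V → V → V
  (u ⊞ v) i = u i + v i

  _⋆_ : Carrier → V → V
  (r ⋆ u) i = r * u i

  ⟨_,_⟩ : V → V → Carrier
  ⟨ u , v ⟩ = sum (λ i → u i * v i)

  ≋-refl : ∀ {u} → u ≋ u
  ≋-refl i = refl

  ≋-sym : ∀ {u v} → u ≋ v → v ≋ u
  ≋-sym p i = sym (p i)

  ≋-trans : ∀ {u v w} → u ≋ v → v ≋ w → u ≋ w
  ≋-trans p q i = trans (p i) (q i)

  ⊞-cong : ∀ {u u′ v v′} → u ≋ u′ → v ≋ v′ → u ⊞ v ≋ u′ ⊞ v′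
  ⊞-cong p q i = +-cong (p i) (q i)

  ⋆-cong : ∀ {r u v} → u ≋ v → r ⋆ u ≋ r ⋆ v
  ⋆-cong p i = *-congˡ (p i)

  ⋆-0 : ∀ {r} → r ⋆ 0ⱽ ≋ 0ⱽ
  ⋆-0 i = zeroʳ _

  ≋-setoid : Setoid c ℓ
  ≋-setoid = Functional.setoid setoid n

  infixl 6 _⊕_
  infixr 7 _⊙_

  _⊕_ : ∀ {a b} → a ≈ 0# → b ≈ 0# → a + b ≈ 0#
  p ⊕ q = trans (+-cong p q) (+-identityˡ 0#)

  _⊙_ : ∀ q {a} → a ≈ 0# → ι q * a ≈ 0#
  q ⊙ p = trans (*-congˡ p) (zeroʳ (ι q))

  -- `vanish` and `modulo` do linear elimination: the first argument, usually built with `_⊕_` and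
  -- `_⊙_`, certifies that a rational combination of known relations is zero; the second, a
  -- ring-solver identity, expresses the goal through that combination.
  vanish : ∀ {a r} → r ≈ 0# → a ≈ r → a ≈ 0#
  vanish p q = trans q p

  modulo : ∀ {a b r} → r ≈ 0# → a ≈ b + r → a ≈ b
  modulo p q = trans q (trans (+-congˡ p) (+-identityʳ _))

-- The abstract form of JH(u) v. In the application the scalars are polynomials and `u` ranges over
-- all tuples of polynomials; this freedom in `u` allows `nilpotent` to be linearised by replacing
-- `u` with `u ⊞ t ⋆ v`.
record NilAlgebra {c ℓ} (A : Commutativeℚ-Algebra c ℓ) (n : ℕ) : Set (c ⊔ ℓ) where
  open Vectors A n
  infixr 7 _·_
  field
    _·_       : V → V → V
    ·-cong    : ∀ {u u′ v v′} → u ≋ u′ → v ≋ v′ → u · v ≋ u′ · v′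
    ·-comm    : ∀ u v → u · v ≋ v · u
    ·-⊞       : ∀ u v w → u · (v ⊞ w) ≋ u · v ⊞ u · w
    ·-⋆       : ∀ u r v → u · (r ⋆ v) ≋ r ⋆ (u · v)
    invariant : ∀ u v w → ⟨ u · v , w ⟩ ≈ ⟨ v , u · w ⟩
    nilpotent : ∀ u v → u · u · u · u · v ≋ 0ⱽ
    nondegenerate : ∀ v → (∀ u → ⟨ u , v ⟩ ≈ 0#) → v ≋ 0ⱽ

-- Polarisation of the nilpotency identity.

module NilAlgebraProperties {c ℓ} {A : Commutativeℚ-Algebra c ℓ} {n : ℕ} (L : NilAlgebra A n) where
  open Vectors A n
  open NilAlgebra L
  open SetoidReasoning ≋-setoid

  ·-congˡ : ∀ {u v w} → v ≋ w → u · v ≋ u · w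
  ·-congˡ = ·-cong ≋-refl

  ·-congʳ : ∀ {u v w} → v ≋ w → v · u ≋ w · u
  ·-congʳ p = ·-cong p ≋-refl

  ·-zeroʳ : ∀ u → u · 0ⱽ ≋ 0ⱽ
  ·-zeroʳ u = begin
    u · 0ⱽ        ≈⟨ ·-congˡ ⋆-0 ⟨
    u · (0# ⋆ 0ⱽ) ≈⟨ ·-⋆ u 0# 0ⱽ ⟩
    0# ⋆ (u · 0ⱽ) ≈⟨ (λ i → zeroˡ _) ⟩
    0ⱽ            ∎

  ·-zeroˡ : ∀ u → 0ⱽ · u ≋ 0ⱽ
  ·-zeroˡ u = ≋-trans (·-comm 0ⱽ u) (·-zeroʳ u)

  ⊞-· : ∀ u v w → (v ⊞ w) · u ≋ v · u ⊞ w · u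
  ⊞-· u v w = ≋-trans (·-comm _ _) (≋-trans (·-⊞ u v w) (⊞-cong (·-comm u v) (·-comm u w)))

  ⋆-· : ∀ u r v → (r ⋆ v) · u ≋ r ⋆ (v · u)
  ⋆-· u r v = ≋-trans (·-comm _ _) (≋-trans (·-⋆ u r v) (⋆-cong (·-comm u v)))

  -- The zero vector in the form in which the ring solver produces it.

  0̂ : V
  0̂ _ = ι 0ℚ

  0̂≋0 : 0̂ ≋ 0ⱽ
  0̂≋0 i = 0#-homo

  hat : ∀ {u} → u ≋ 0ⱽ → u ≋ 0̂
  hat p = ≋-trans p (≋-sym 0̂≋0)

  ·-nullʳ : ∀ {u v} → v ≋ 0ⱽ → u · v ≋ 0ⱽ
  ·-nullʳ p = ≋-trans (·-congˡ p) (·-zeroʳ _)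

  ·-nullˡ : ∀ {u v} → v ≋ 0ⱽ → v · u ≋ 0ⱽ
  ·-nullˡ p = ≋-trans (·-congʳ p) (·-zeroˡ _)

  ⊞-null : ∀ {u v} → u ≋ 0ⱽ → v ≋ 0ⱽ → u ⊞ v ≋ 0ⱽ
  ⊞-null p q i = p i ⊕ q i

  ⊞-nullˡ : ∀ {u v w} → u ≋ 0ⱽ → v ≋ w → u ⊞ v ≋ w
  ⊞-nullˡ p q i = trans (+-cong (p i) (q i)) (+-identityˡ _)

  ⊞-nullʳ : ∀ {u v w} → v ≋ 0ⱽ → u ≋ w → u ⊞ v ≋ w
  ⊞-nullʳ p q i = trans (+-cong (q i) (p i)) (+-identityʳ _)

  ⋆-null : ∀ {r u v} → u · v ≋ 0ⱽ → u · (r ⋆ v) ≋ 0ⱽ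
  ⋆-null p = ≋-trans (·-⋆ _ _ _) (≋-trans (⋆-cong p) ⋆-0)

  ⋆-nullˡ : ∀ {r u v} → v · u ≋ 0ⱽ → (r ⋆ v) · u ≋ 0ⱽ
  ⋆-nullˡ p = ≋-trans (⋆-· _ _ _) (≋-trans (⋆-cong p) ⋆-0)

  comm-null : ∀ {u v} → u · v ≋ 0ⱽ → v · u ≋ 0ⱽ
  comm-null p = ≋-trans (·-comm _ _) p

  -- A list of vectors is read as a polynomial in t with these coefficients.

  eval : Carrier → List V → V
  eval t []       = 0̂
  eval t (p ∷ ps) = p ⊞ t ⋆ eval t ps

  -- Interpolation at the nodes 0, ±1, ±2.

  eval≋0⇒coefficients≋0 : ∀ {c₀ c₁ c₂ c₃ c₄} →
    (∀ t → eval t (c₀ ∷ c₁ ∷ c₂ ∷ c₃ ∷ c₄ ∷ []) ≋ 0ⱽ) → (c₁ ≋ 0ⱽ) × (c₂ ≋ 0ⱽ)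
  eval≋0⇒coefficients≋0 {c₀} {c₁} {c₂} {c₃} {c₄} h =
    (λ i → vanish
      (⅔ ⊙ at 1ℚ i ⊕ -⅔ ⊙ at -1ℚ i ⊕ -¹⁄₁₂ ⊙ at 2ℚ i ⊕ ¹⁄₁₂ ⊙ at -2ℚ i)
      (solve 5 (λ c₀ c₁ c₂ c₃ c₄ → c₁ :=
          con ⅔ :* e 1ℚ c₀ c₁ c₂ c₃ c₄ :+ con -⅔ :* e -1ℚ c₀ c₁ c₂ c₃ c₄
            :+ con -¹⁄₁₂ :* e 2ℚ c₀ c₁ c₂ c₃ c₄ :+ con ¹⁄₁₂ :* e -2ℚ c₀ c₁ c₂ c₃ c₄)
        refl (c₀ i) (c₁ i) (c₂ i) (c₃ i) (c₄ i))) ,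
    (λ i → vanish
      (-⁵⁄₄ ⊙ at 0ℚ i ⊕ ⅔ ⊙ at 1ℚ i ⊕ ⅔ ⊙ at -1ℚ i ⊕ -¹⁄₂₄ ⊙ at 2ℚ i ⊕ -¹⁄₂₄ ⊙ at -2ℚ i)
      (solve 5 (λ c₀ c₁ c₂ c₃ c₄ → c₂ :=
          con -⁵⁄₄ :* e 0ℚ c₀ c₁ c₂ c₃ c₄
            :+ con ⅔ :* e 1ℚ c₀ c₁ c₂ c₃ c₄ :+ con ⅔ :* e -1ℚ c₀ c₁ c₂ c₃ c₄
            :+ con -¹⁄₂₄ :* e 2ℚ c₀ c₁ c₂ c₃ c₄ :+ con -¹⁄₂₄ :* e -2ℚ c₀ c₁ c₂ c₃ c₄)
        refl (c₀ i) (c₁ i) (c₂ i) (c₃ i) (c₄ i)))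
    where
    at : ∀ q → eval (ι q) (c₀ ∷ c₁ ∷ c₂ ∷ c₃ ∷ c₄ ∷ []) ≋ 0ⱽ
    at q = h (ι q)
    e : ℚ → (c₀ c₁ c₂ c₃ c₄ : Polynomial 5) → Polynomial 5
    e t c₀ c₁ c₂ c₃ c₄ =
      c₀ :+ con t :* (c₁ :+ con t :* (c₂ :+ con t :* (c₃ :+ con t :* (c₄ :+ con t :* con 0ℚ))))

  -- Multiplication of a polynomial in t by x + t y.

  carry : V → V → V → List V → List V
  carry x y p []       = y · p ∷ []
  carry x y p (q ∷ qs) = x · q ⊞ y · p ∷ carry x y q qs

  mul : V → V → List V → List V
  mul x y []       = []
  mul x y (p ∷ ps) = x · p ∷ carry x y p ps

  module _ (t : Carrier) where

    ·-expand : ∀ x y p q → (x ⊞ t ⋆ y) · (p ⊞ t ⋆ q) ≋ x · p ⊞ t ⋆ (y · p ⊞ (x ⊞ t ⋆ y) · q)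
    ·-expand x y p q = ≋-trans (·-⊞ _ _ _)
      (≋-trans (⊞-cong (≋-trans (⊞-· _ _ _) (⊞-cong ≋-refl (⋆-· _ _ _))) (·-⋆ _ _ _))
       (λ i → trans (+-assoc _ _ _) (+-congˡ (sym (distribˡ _ _ _)))))

    ·-0̂ : ∀ u → u · 0̂ ≋ 0̂
    ·-0̂ u = ≋-trans (·-congˡ 0̂≋0) (≋-trans (·-zeroʳ u) (≋-sym 0̂≋0))

    eval-carry : ∀ x y p qs → y · p ⊞ (x ⊞ t ⋆ y) · eval t qs ≋ eval t (carry x y p qs)
    eval-carry x y p []       = ⊞-cong ≋-refl
      (≋-trans (·-0̂ _) (λ i → sym (trans (*-congˡ 0#-homo) (trans (zeroʳ t) (sym 0#-homo)))))
    eval-carry x y p (q ∷ qs) = begin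
      y · p ⊞ (x ⊞ t ⋆ y) · (q ⊞ t ⋆ eval t qs)                ≈⟨ ⊞-cong ≋-refl (·-expand x y q _) ⟩
      y · p ⊞ (x · q ⊞ t ⋆ (y · q ⊞ (x ⊞ t ⋆ y) · eval t qs))  ≈⟨ ⊞-cong ≋-refl (⊞-cong ≋-refl (⋆-cong (eval-carry x y q qs))) ⟩
      y · p ⊞ (x · q ⊞ t ⋆ eval t (carry x y q qs))            ≈⟨ (λ i → trans (sym (+-assoc _ _ _)) (+-congʳ (+-comm _ _))) ⟩
      x · q ⊞ y · p ⊞ t ⋆ eval t (carry x y q qs)              ∎

    eval-mul : ∀ x y ps → (x ⊞ t ⋆ y) · eval t ps ≋ eval t (mul x y ps)
    eval-mul x y []       = ·-0̂ _
    eval-mul x y (p ∷ ps) =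
      ≋-trans (·-expand x y p (eval t ps)) (⊞-cong ≋-refl (⋆-cong (eval-carry x y p ps)))

  infixl 6 _+ᵗ_
  infixl 7 _·ᵗ_

  -- The Cauchy product in `t`. Where `mul` has a linear left factor, `nil-cubic` multiplies two
  -- words that both depend on `t`.
  _+ᵗ_ _·ᵗ_ : List V → List V → List V
  []       +ᵗ qs       = qs
  (p ∷ ps) +ᵗ []       = p ∷ ps
  (p ∷ ps) +ᵗ (q ∷ qs) = p ⊞ q ∷ ps +ᵗ qs
  []       ·ᵗ qs = []
  (p ∷ ps) ·ᵗ qs = List.map (p ·_) qs +ᵗ (0̂ ∷ ps ·ᵗ qs)

  module _ (t : Carrier) where

    eval-+ᵗ : ∀ ps qs → eval t (ps +ᵗ qs) ≋ eval t ps ⊞ eval t qs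
    eval-+ᵗ [] qs i = sym (trans (+-congʳ 0#-homo) (+-identityˡ _))
    eval-+ᵗ (p ∷ ps) [] i = sym (trans (+-congˡ 0#-homo) (+-identityʳ _))
    eval-+ᵗ (p ∷ ps) (q ∷ qs) i = trans (+-congˡ (*-congˡ (eval-+ᵗ ps qs i)))
      (solve 5 (λ p q t e f → p :+ q :+ t :* (e :+ f) := (p :+ t :* e) :+ (q :+ t :* f)) refl
        (p i) (q i) t (eval t ps i) (eval t qs i))

    eval-map : ∀ p qs → eval t (List.map (p ·_) qs) ≋ p · eval t qs
    eval-map p []       = ≋-sym (·-0̂ t p)
    eval-map p (q ∷ qs) = ≋-trans (⊞-cong ≋-refl (⋆-cong (eval-map p qs)))
      (≋-sym (≋-trans (·-⊞ _ _ _) (⊞-cong ≋-refl (·-⋆ _ _ _))))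

    eval-·ᵗ : ∀ ps qs → eval t (ps ·ᵗ qs) ≋ eval t ps · eval t qs
    eval-·ᵗ []       qs = ≋-sym (≋-trans (·-comm _ _) (·-0̂ t _))
    eval-·ᵗ (p ∷ ps) qs = begin
      eval t (List.map (p ·_) qs +ᵗ (0̂ ∷ ps ·ᵗ qs))          ≈⟨ eval-+ᵗ (List.map (p ·_) qs) _ ⟩
      eval t (List.map (p ·_) qs) ⊞ (0̂ ⊞ t ⋆ eval t (ps ·ᵗ qs))
        ≈⟨ ⊞-cong (eval-map p qs) (λ i → trans (+-congʳ 0#-homo) (+-identityˡ _)) ⟩
      p · eval t qs ⊞ t ⋆ eval t (ps ·ᵗ qs)             ≈⟨ ⊞-cong ≋-refl (⋆-cong (eval-·ᵗ ps qs)) ⟩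
      p · eval t qs ⊞ t ⋆ (eval t ps · eval t qs)       ≈⟨ ⊞-cong ≋-refl (⋆-· _ _ _) ⟨
      p · eval t qs ⊞ (t ⋆ eval t ps) · eval t qs       ≈⟨ ⊞-· _ _ _ ⟨
      (p ⊞ t ⋆ eval t ps) · eval t qs                   ∎

  -- The j-th entry of words x y k w is the sum of all words of length k in the
  -- multiplications by x and y, with j factors y, applied to w.

  words : V → V → ℕ → V → List V
  words x y zero    w = w ∷ []
  words x y (suc k) w = mul x y (words x y k w)

  power : V → ℕ → V → V
  power x zero    w = w
  power x (suc k) w = x · power x k w

  eval-words : ∀ t x y k w → eval t (words x y k w) ≋ power (x ⊞ t ⋆ y) k w
  eval-words t x y zero    w i = trans (+-congˡ (trans (*-congˡ 0#-homo) (zeroʳ t))) (+-identityʳ _)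
  eval-words t x y (suc k) w =
    ≋-trans (≋-sym (eval-mul t x y (words x y k w))) (·-congˡ (eval-words t x y k w))

  -- The fourth power of multiplication by `x ⊞ t ⋆ y` kills `w` for every scalar `t`, so its
  -- coefficients at `t` and `t²` vanish. The nesting is the one that `words` produces.
  nil-words : ∀ x y w →
    (x · (x · (x · y · w ⊞ y · x · w) ⊞ y · x · x · w) ⊞ y · x · x · x · w ≋ 0ⱽ) ×
    (x · (x · y · y · w ⊞ y · (x · y · w ⊞ y · x · w))
      ⊞ y · (x · (x · y · w ⊞ y · x · w) ⊞ y · x · x · w) ≋ 0ⱽ)
  nil-words x y w = eval≋0⇒coefficients≋0 λ t →
    ≋-trans (eval-words t x y 4 w) (nilpotent (x ⊞ t ⋆ y) w)

  ⟨⟩-congʳ : ∀ {u v w} → v ≋ w → ⟨ v , u ⟩ ≈ ⟨ w , u ⟩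
  ⟨⟩-congʳ p = sum-cong-≋ (λ i → *-congʳ (p i))

  ⟨⟩-⊞ˡ : ∀ u v w → ⟨ u ⊞ v , w ⟩ ≈ ⟨ u , w ⟩ + ⟨ v , w ⟩
  ⟨⟩-⊞ˡ u v w = trans (sum-cong-≋ (λ i → distribʳ (w i) (u i) (v i))) (∑-distrib-+ {n} _ _)

  ⟨⟩-⊞ʳ : ∀ u v w → ⟨ u , v ⊞ w ⟩ ≈ ⟨ u , v ⟩ + ⟨ u , w ⟩
  ⟨⟩-⊞ʳ u v w = trans (sum-cong-≋ (λ i → distribˡ (u i) (v i) (w i))) (∑-distrib-+ {n} _ _)

  -- `invariant` moves the left factor across; commuting first leaves `y` alone in its slot, as
  -- `nondegenerate` requires.
  swap : ∀ y u z → ⟨ y · u , z ⟩ ≈ ⟨ y , u · z ⟩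
  swap y u z = trans (⟨⟩-congʳ (·-comm y u)) (invariant u y z)

  -- Pairing the linearised identity nil-words with z and moving every factor
  -- except y to the right shows that this vector is orthogonal to every y.

  nil-cubic : ∀ x w z →
    (x · x · x · w) · z ⊞ (x · x · w) · (x · z) ⊞ (x · w) · (x · x · z) ⊞ w · (x · x · x · z) ≋ 0ⱽ
  nil-cubic x w z = nondegenerate _ λ y → trans
    (trans (⟨⟩-⊞ʳ _ _ _) (+-congʳ (trans (⟨⟩-⊞ʳ _ _ _) (+-congʳ (⟨⟩-⊞ʳ _ _ _)))))
    (trans (reverse _ _ _ _) (trans (sym (moved y)) (trans (⟨⟩-congʳ (proj₁ (nil-words x y w)))
      (trans (sum-cong-≋ (λ i → zeroˡ (z i))) (sum-replicate-zero n)))))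
    where
    reverse : ∀ p q r s → p + q + r + s ≈ s + r + q + p
    reverse = solve 4 (λ p q r s → p :+ q :+ r :+ s := s :+ r :+ q :+ p) refl
    moved : ∀ y → ⟨ x · (x · (x · y · w ⊞ y · x · w) ⊞ y · x · x · w) ⊞ y · x · x · x · w , z ⟩ ≈
      ⟨ y , w · (x · x · x · z) ⟩ + ⟨ y , (x · w) · (x · x · z) ⟩
        + ⟨ y , (x · x · w) · (x · z) ⟩ + ⟨ y , (x · x · x · w) · z ⟩
    moved y = trans (⟨⟩-⊞ˡ _ _ _) (+-cong
      (trans (invariant _ _ _) (trans (⟨⟩-⊞ˡ _ _ _) (+-cong
        (trans (invariant _ _ _) (trans (⟨⟩-⊞ˡ _ _ _) (+-cong
          (trans (invariant _ _ _) (swap _ _ _)) (swap _ _ _))))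
        (swap _ _ _))))
      (swap _ _ _))

  -- `nil-cubic` at `x ⊞ t ⋆ y`, read off at `t` and `t²`. In the names, the first index is the
  -- length of the words and the second the number of factors `y`.
  nil-cubic-words : ∀ x y w z →
    let w₁₀ = x · w ; w₁₁ = y · w ; w₂₀ = x · w₁₀ ; w₂₁ = x · w₁₁ ⊞ y · w₁₀ ; w₂₂ = y · w₁₁
        w₃₁ = x · w₂₁ ⊞ y · w₂₀ ; w₃₂ = x · w₂₂ ⊞ y · w₂₁
        z₁₀ = x · z ; z₁₁ = y · z ; z₂₀ = x · z₁₀ ; z₂₁ = x · z₁₁ ⊞ y · z₁₀ ; z₂₂ = y · z₁₁
        z₃₁ = x · z₂₁ ⊞ y · z₂₀ ; z₃₂ = x · z₂₂ ⊞ y · z₂₁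
    in (w₃₁ · z ⊞ w₂₁ · z₁₀ ⊞ w₁₁ · z₂₀ ⊞ w₂₀ · z₁₁ ⊞ w₁₀ · z₂₁ ⊞ w · z₃₁ ≋ 0ⱽ) ×
       (w₃₂ · z ⊞ w₂₂ · z₁₀ ⊞ w₂₁ · z₁₁ ⊞ w₁₁ · z₂₁ ⊞ w₁₀ · z₂₂ ⊞ w · z₃₂ ≋ 0ⱽ)
  nil-cubic-words x y w z =
    (λ i → vanish (proj₁ coefficients i)
      (solve 6 (λ p q r s t u → p :+ q :+ r :+ s :+ t :+ u :=
          (p :+ con 0ℚ) :+ (s :+ (q :+ con 0ℚ)) :+ (t :+ (r :+ con 0ℚ)) :+ u :+ con 0ℚ)
        refl _ _ _ _ _ _)) ,
    (λ i → vanish (proj₂ coefficients i)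
      (solve 6 (λ p q r s t u → p :+ q :+ r :+ s :+ t :+ u :=
          (p :+ con 0ℚ) :+ (r :+ (q :+ con 0ℚ)) :+ (t :+ s) :+ u :+ con 0ℚ)
        refl _ _ _ _ _ _))
    where
    W : ℕ → V → List V
    W = words x y
    product : ℕ → ℕ → List V
    product k l = W k w ·ᵗ W l z
    -- The four products have degree 3 in `t`; this list pads their sum to the five coefficients
    -- that the interpolation expects. The summands `con 0ℚ` above come from it and from the shifts
    -- in `_·ᵗ_`.
    zeros : List V
    zeros = 0̂ ∷ 0̂ ∷ 0̂ ∷ 0̂ ∷ 0̂ ∷ []
    eval-zeros : ∀ t → eval t zeros ≋ 0ⱽ
    eval-zeros t i = trans (solve 1 (λ t →
      con 0ℚ :+ t :* (con 0ℚ :+ t :* (con 0ℚ :+ t :* (con 0ℚ :+ t :* (con 0ℚ :+ t :* con 0ℚ))))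
        := con 0ℚ) refl t) 0#-homo
    eval-product : ∀ t k l →
      eval t (product k l) ≋ power (x ⊞ t ⋆ y) k w · power (x ⊞ t ⋆ y) l z
    eval-product t k l = ≋-trans (eval-·ᵗ t (W k w) (W l z))
      (·-cong (eval-words t x y k w) (eval-words t x y l z))
    eval-sum : ∀ t {ps qs u v} → eval t ps ≋ u → eval t qs ≋ v → eval t (ps +ᵗ qs) ≋ u ⊞ v
    eval-sum t {ps} {qs} p q = ≋-trans (eval-+ᵗ t ps qs) (⊞-cong p q)
    coefficients = eval≋0⇒coefficients≋0 λ t → ≋-trans
      (eval-sum t {product 3 0 +ᵗ product 2 1 +ᵗ product 1 2 +ᵗ product 0 3} {zeros}
        (eval-sum t {product 3 0 +ᵗ product 2 1 +ᵗ product 1 2} {product 0 3}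
          (eval-sum t {product 3 0 +ᵗ product 2 1} {product 1 2}
            (eval-sum t {product 3 0} {product 2 1} (eval-product t 3 0) (eval-product t 2 1))
            (eval-product t 1 2))
          (eval-product t 0 3))
        (eval-zeros t))
      (λ i → trans (+-identityʳ _) (nil-cubic (x ⊞ t ⋆ y) w z i))

-- The multiplication table of the subalgebra generated by one element.

module OneGenerator {κ ℓ} {A : Commutativeℚ-Algebra κ ℓ} {n : ℕ} (L : NilAlgebra A n) where
  open Vectors A n
  open NilAlgebra L
  open NilAlgebraProperties L

  module _ (x : V) where

    -- Iterated products are passed as vectors already evaluated up to `_≋_`, so that an identity
    -- can be instantiated at the table entries found so far.
    record Powers (w w₁ w₂ w₃ : V) : Set ℓ where
      constructor powers
      field
        x¹ : x · w ≋ w₁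
        x² : x · w₁ ≋ w₂
        x³ : x · w₂ ≋ w₃

    -- pₖ is the sum of the words of length k applied to w with exactly one factor y.

    record Words₁ (y w w₁ w₂ p₁ p₂ p₃ : V) : Set ℓ where
      constructor words₁
      field
        x¹  : x · w ≋ w₁
        x²  : x · w₁ ≋ w₂
        y·w : y · w ≋ p₁
        w²  : x · p₁ ⊞ y · w₁ ≋ p₂
        w³  : x · p₂ ⊞ y · w₂ ≋ p₃

    -- rₖ is the sum of the words of length k applied to w with exactly two factors y.

    record Words₂ (y w w₁ w₂ p₁ p₂ p₃ r₂ r₃ : V) : Set ℓ where
      constructor words₂
      field
        one : Words₁ y w w₁ w₂ p₁ p₂ p₃
        y²  : y · p₁ ≋ r₂
        w³  : x · r₂ ⊞ y · p₂ ≋ r₃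
      open Words₁ one public hiding (w³)

    module _ {y w w₁ w₂ p₁ p₂ p₃ : V} where

      collapse₁ : Words₁ y w w₁ w₂ p₁ p₂ p₃ →
        (x · y · w ⊞ y · x · w ≋ p₂) ×
        (x · (x · y · w ⊞ y · x · w) ⊞ y · x · x · w ≋ p₃)
      collapse₁ W = two ,
        ≋-trans (⊞-cong (·-congˡ two) (·-congˡ (≋-trans (·-congˡ x¹) x²))) w³
        where
        open Words₁ W
        two = ≋-trans (⊞-cong (·-congˡ y·w) (·-congˡ x¹)) w²

      nil-words₁ : Words₁ y w w₁ w₂ p₁ p₂ p₃ → x · p₃ ⊞ y · x · w₂ ≋ 0ⱽ
      nil-words₁ W = ≋-trans (≋-sym (⊞-cong (·-congˡ (proj₂ (collapse₁ W)))
        (·-congˡ (·-congˡ (≋-trans (·-congˡ x¹) x²))))) (proj₁ (nil-words x y w))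
        where open Words₁ W

      collapse₂ : ∀ {r₂ r₃} → Words₂ y w w₁ w₂ p₁ p₂ p₃ r₂ r₃ →
        (y · y · w ≋ r₂) × (x · y · y · w ⊞ y · (x · y · w ⊞ y · x · w) ≋ r₃)
      collapse₂ W = yy , ≋-trans (⊞-cong (·-congˡ yy) (·-congˡ (proj₁ (collapse₁ one)))) w³
        where
        open Words₂ W
        yy = ≋-trans (·-congˡ y·w) y²

      nil-words₂ : ∀ {r₂ r₃} → Words₂ y w w₁ w₂ p₁ p₂ p₃ r₂ r₃ → x · r₃ ⊞ y · p₃ ≋ 0ⱽ
      nil-words₂ W = ≋-trans (≋-sym (⊞-cong (·-congˡ (proj₂ (collapse₂ W)))
        (·-congˡ (proj₂ (collapse₁ one))))) (proj₂ (nil-words x y w))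
        where open Words₂ W

    substitute : ∀ {u v} → u ≋ 0ⱽ → u ≋ v → v ≋ 0ⱽ
    substitute p q = ≋-trans (≋-sym q) p

    -- `cubic₀`, `cubic₁` and `cubic₂` are the components of polarised `nil-cubic` with zero, one
    -- and two factors `y`, rewritten with the recorded values.
    cubic₀ : ∀ {w w₁ w₂ w₃ z z₁ z₂ z₃} → Powers w w₁ w₂ w₃ → Powers z z₁ z₂ z₃ →
      w₃ · z ⊞ w₂ · z₁ ⊞ w₁ · z₂ ⊞ w · z₃ ≋ 0ⱽ
    cubic₀ {w} {z = z} W Z = substitute (nil-cubic x w z)
      (⊞-cong (⊞-cong (⊞-cong (·-congʳ (third W)) (·-cong (second W) Z.x¹))
        (·-cong W.x¹ (second Z))) (·-congˡ (third Z)))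
      where
      module W = Powers W
      module Z = Powers Z
      second : ∀ {w w₁ w₂ w₃} → Powers w w₁ w₂ w₃ → x · x · w ≋ w₂
      second P = ≋-trans (·-congˡ (Powers.x¹ P)) (Powers.x² P)
      third : ∀ {w w₁ w₂ w₃} → Powers w w₁ w₂ w₃ → x · x · x · w ≋ w₃
      third P = ≋-trans (·-congˡ (second P)) (Powers.x³ P)

    module _ {y w w₁ w₂ p₁ p₂ p₃ z z₁ z₂ q₁ q₂ q₃ : V} where

      cubic₁ : Words₁ y w w₁ w₂ p₁ p₂ p₃ → Words₁ y z z₁ z₂ q₁ q₂ q₃ →
        p₃ · z ⊞ p₂ · z₁ ⊞ p₁ · z₂ ⊞ w₂ · q₁ ⊞ w₁ · q₂ ⊞ w · q₃ ≋ 0ⱽ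
      cubic₁ W Z = substitute (proj₁ (nil-cubic-words x y w z))
        (⊞-cong (⊞-cong (⊞-cong (⊞-cong (⊞-cong
          (·-congʳ (proj₂ (collapse₁ W)))
          (·-cong (proj₁ (collapse₁ W)) Z.x¹))
          (·-cong W.y·w (≋-trans (·-congˡ Z.x¹) Z.x²)))
          (·-cong (≋-trans (·-congˡ W.x¹) W.x²) Z.y·w))
          (·-cong W.x¹ (proj₁ (collapse₁ Z))))
          (·-congˡ (proj₂ (collapse₁ Z))))
        where
        module W = Words₁ W
        module Z = Words₁ Z

      cubic₂ : ∀ {r₂ r₃ s₂ s₃} →
        Words₂ y w w₁ w₂ p₁ p₂ p₃ r₂ r₃ → Words₂ y z z₁ z₂ q₁ q₂ q₃ s₂ s₃ →
        r₃ · z ⊞ r₂ · z₁ ⊞ p₂ · q₁ ⊞ p₁ · q₂ ⊞ w₁ · s₂ ⊞ w · s₃ ≋ 0ⱽ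
      cubic₂ W Z = substitute (proj₂ (nil-cubic-words x y w z))
        (⊞-cong (⊞-cong (⊞-cong (⊞-cong (⊞-cong
          (·-congʳ (proj₂ (collapse₂ W)))
          (·-cong (proj₁ (collapse₂ W)) Z.x¹))
          (·-cong (proj₁ (collapse₁ W.one)) Z.y·w))
          (·-cong W.y·w (proj₁ (collapse₁ Z.one))))
          (·-cong W.x¹ (proj₁ (collapse₂ Z))))
          (·-congˡ (proj₂ (collapse₂ Z))))
        where
        module W = Words₂ W
        module Z = Words₂ Z

    infixl 5 _∙_
    _∙_ : ∀ {u u′ v v′} → u ≋ u′ → v ≋ v′ → u ⊞ v ≋ u′ ⊞ v′
    _∙_ = ⊞-cong

    a b c d e f : V
    a = x · x
    b = x · a
    c = x · b
    d = a · a
    e = x · d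
    f = x · e

    xc : x · c ≋ 0ⱽ
    xc = nilpotent x x

    -- Naming: `p` followed by a vector records its successive multiples by `x`; `o` records the
    -- words with one factor `a` applied to it, and a final subscript two those with two factors
    -- `a`.
    px : Powers x a b c
    px = powers ≋-refl ≋-refl ≋-refl

    pa : Powers a b c 0ⱽ
    pa = powers ≋-refl ≋-refl xc

    pb : Powers b c 0ⱽ 0ⱽ
    pb = powers ≋-refl xc (·-zeroʳ x)

    pc : Powers c 0ⱽ 0ⱽ 0ⱽ
    pc = powers xc (·-zeroʳ x) (·-zeroʳ x)

    -- At `x` and `x`, `cubic₀` is twice `a · b` plus two copies of `x · c`, which is zero by
    -- nilpotency.
    ab : a · b ≋ 0ⱽ
    ab i = vanish (½ ⊙ substitute (cubic₀ px px) (hat (comm-null xc) ∙ ·-comm b a ∙ ≋-refl ∙ hat xc) i)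
      (solve 1 (λ p → p := con ½ :* (con 0ℚ :+ p :+ p :+ con 0ℚ)) refl _)

    ox : Words₁ a x a b b (c ⊞ d) e
    ox = words₁ ≋-refl ≋-refl (·-comm a x) ≋-refl
      (⊞-nullʳ ab (≋-trans (·-⊞ x c d) (⊞-nullˡ xc ≋-refl)))

    -- The part of the nilpotency linear in `a`, applied to `x`. The values `ac`, `bb` and `ad` are
    -- all solved from this relation.
    f+ac : f ⊞ a · c ≋ 0ⱽ
    f+ac = nil-words₁ ox

    ac : a · c ≋ ι -1ℚ ⋆ f
    ac i = modulo (1ℚ ⊙ f+ac i) (solve 2 (λ f p → p := con -1ℚ :* f :+ con 1ℚ :* (f :+ p)) refl (f i) _)

    bb : b · b ≋ ι 2ℚ ⋆ f
    bb i = modulo (1ℚ ⊙ substitute (cubic₀ px pa) (·-comm c a ∙ ≋-refl ∙ ≋-refl ∙ hat (·-zeroʳ x)) i ⊕ -2ℚ ⊙ f+ac i)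
      (solve 3 (λ f p q → q := con 2ℚ :* f :+
        (con 1ℚ :* (p :+ q :+ p :+ con 0ℚ) :+ con -2ℚ :* (f :+ p))) refl (f i) ((a · c) i) _)

    -- Half of this `cubic₁` is the sum of `f`, `a · c`, `a · d` and `b · b`. Subtracting `f+ac`
    -- leaves `a · d` as the negative of `b · b`.
    ad : a · d ≋ ι -2ℚ ⋆ f
    ad i = modulo (½ ⊙ substitute (cubic₁ ox ox)
        (·-comm e x ∙ ≋-trans (·-comm _ a) (·-⊞ a c d) ∙ bb ∙ bb ∙ ·-⊞ a c d ∙ ≋-refl) i ⊕ -1ℚ ⊙ f+ac i)
      (solve 3 (λ f p q → q := con -2ℚ :* f :+
        (con ½ :* (f :+ (p :+ q) :+ con 2ℚ :* f :+ con 2ℚ :* f :+ (p :+ q) :+ f) :+ con -1ℚ :* (f :+ p)))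
        refl (f i) ((a · c) i) _)

    bc : b · c ≋ 0ⱽ
    bc i = vanish (½ ⊙ substitute (cubic₀ px pb) (·-comm c b ∙ ≋-refl ∙ hat (·-zeroʳ a) ∙ hat (·-zeroʳ x)) i)
      (solve 1 (λ p → p := con ½ :* (p :+ p :+ con 0ℚ :+ con 0ℚ)) refl _)

    -- The linear part of the nilpotency in direction `b`: the word of length three is `b · b`, that
    -- is twice `f`, so twice `x · f` appears beside `b · c`.
    xf : x · f ≋ 0ⱽ
    xf i = vanish (½ ⊙ substitute (nil-words₁ (words₁ ≋-refl ≋-refl (·-comm b x)
          (⊞-null xc (comm-null ab)) (⊞-nullˡ (·-zeroʳ x) bb)))
        (·-⋆ x (ι 2ℚ) f ∙ hat bc) i)
      (solve 1 (λ p → p := con ½ :* (con 2ℚ :* p :+ con 0ℚ)) refl _)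

    oa : Words₁ a a b c d e 0ⱽ
    oa = words₁ ≋-refl ≋-refl ≋-refl (⊞-nullʳ ab ≋-refl) f+ac

    ox₂ : Words₂ a x a b b (c ⊞ d) e 0ⱽ (ι -3ℚ ⋆ f)
    ox₂ = words₂ ox ab (⊞-nullˡ (·-zeroʳ x) (≋-trans (·-⊞ a c d) (≋-trans (ac ∙ ad)
      (λ i → solve 1 (λ f → con -1ℚ :* f :+ con -2ℚ :* f := con -3ℚ :* f) refl (f i)))))

    -- The part of the nilpotency quadratic in `a`, applied to `x`, is `a · e` minus three times
    -- `x · f`.
    ae : a · e ≋ 0ⱽ
    ae = ≋-trans (≋-sym (⊞-nullˡ (⋆-null xf) ≋-refl)) (nil-words₂ ox₂)

    bd : b · d ≋ 0ⱽ
    bd i = vanish (½ ⊙ substitute (cubic₁ ox oa)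
        (hat (comm-null ae) ∙ ≋-trans (·-comm _ b) (≋-trans (·-⊞ b c d) (⊞-nullˡ bc ≋-refl)) ∙ hat bc
          ∙ ≋-refl ∙ hat ae ∙ hat (·-zeroʳ x)) i)
      (solve 1 (λ p → p := con ½ :* (con 0ℚ :+ p :+ con 0ℚ :+ p :+ con 0ℚ :+ con 0ℚ)) refl _)

    cc : c · c ≋ 0ⱽ
    cc = ≋-trans (≋-sym (⊞-nullʳ (·-zeroʳ x) (⊞-nullʳ (·-zeroʳ a) (⊞-nullʳ (·-zeroʳ b) ≋-refl)))) (cubic₀ px pc)

    -- Direction `d` at `x`: the words of lengths one, two and three with one `d` are `e`, minus
    -- `f`, and zero, which leaves `d · x · b`.
    dc : d · c ≋ 0ⱽ
    dc = ≋-trans (≋-sym (⊞-nullˡ (·-zeroʳ x) ≋-refl)) (nil-words₁ (words₁ {w₁ = a} {p₁ = e}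
      ≋-refl ≋-refl (·-comm d x)
      (λ i → trans (+-congˡ (trans (·-comm d a i) (ad i))) (solve 1 (λ f → f :+ con -2ℚ :* f := con -1ℚ :* f) refl (f i)))
      (⊞-null (⋆-null xf) (comm-null bd))))

    pd : Powers d e f 0ⱽ
    pd = powers ≋-refl ≋-refl xf

    pe : Powers e f 0ⱽ 0ⱽ
    pe = powers ≋-refl xf (·-zeroʳ x)

    ob : Words₁ a b c 0ⱽ 0ⱽ (ι -1ℚ ⋆ f) 0ⱽ
    ob = words₁ ≋-refl xc ab (⊞-nullˡ (·-zeroʳ x) ac) (⊞-null (⋆-null xf) (·-zeroʳ a))

    be+af : b · e ⊞ a · f ≋ 0ⱽ
    be+af = ≋-trans (≋-sym (⊞-nullʳ (·-zeroʳ x) (⊞-cong (⊞-nullˡ (comm-null dc) ≋-refl) ≋-refl))) (cubic₀ px pd)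

    -- `cubic₀` gives the sum of `b · e` and `a · f`, `cubic₁` their difference, so both vanish. The
    -- same pairing settles `ce` and `bf`.
    be-af : b · e ⊞ ι -1ℚ ⋆ (a · f) ≋ 0ⱽ
    be-af i = vanish (1ℚ ⊙ substitute (cubic₁ ox ob)
        (·-comm e b ∙ hat (≋-trans (⊞-· _ _ _) (⊞-null cc dc)) ∙ hat (·-zeroʳ b) ∙ hat (·-zeroʳ b)
          ∙ ·-⋆ a (ι -1ℚ) f ∙ hat (·-zeroʳ x)) i)
      (solve 2 (λ p q → p :+ con -1ℚ :* q :=
          con 1ℚ :* (p :+ con 0ℚ :+ con 0ℚ :+ con 0ℚ :+ con -1ℚ :* q :+ con 0ℚ)) refl _ _)

    be : b · e ≋ 0ⱽ
    be i = vanish (½ ⊙ be+af i ⊕ ½ ⊙ be-af i)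
      (solve 2 (λ p q → p := con ½ :* (p :+ q) :+ con ½ :* (p :+ con -1ℚ :* q)) refl _ _)

    af : a · f ≋ 0ⱽ
    af = ≋-trans (≋-sym (⊞-nullˡ be ≋-refl)) be+af

    oa₂ : Words₂ a a b c d e 0ⱽ (ι -2ℚ ⋆ f) 0ⱽ
    oa₂ = words₂ oa ad (⊞-null (⋆-null xf) ae)

    -- In `cubic₂` at `x` and `a` the middle words multiply to `(c ⊞ d) · d`; the other terms are
    -- multiples of `a · f`, `b · e` or zero.
    dd : d · d ≋ 0ⱽ
    dd = ≋-trans (≋-sym (⊞-nullʳ (·-zeroʳ x) (⊞-nullʳ (⋆-null af) (⊞-nullʳ be
        (⊞-nullˡ (⊞-null (⋆-nullˡ (comm-null af)) (·-zeroˡ b))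
          (≋-trans (⊞-· _ _ _) (⊞-nullˡ (comm-null dc) ≋-refl))))))) (cubic₂ ox₂ oa₂)

    oc : Words₁ a c 0ⱽ 0ⱽ (ι -1ℚ ⋆ f) 0ⱽ 0ⱽ
    oc = words₁ xc (·-zeroʳ x) ac (⊞-null (⋆-null xf) (·-zeroʳ a)) (⊞-null (·-zeroʳ x) (·-zeroʳ a))

    od : Words₁ a d e f (ι -2ℚ ⋆ f) 0ⱽ 0ⱽ
    od = words₁ ≋-refl ≋-refl ad (⊞-null (⋆-null xf) ae) (⊞-null (·-zeroʳ x) af)

    od₂ : Words₂ a d e f (ι -2ℚ ⋆ f) 0ⱽ 0ⱽ 0ⱽ 0ⱽ
    od₂ = words₂ od (⋆-null af) (⊞-null (·-zeroʳ x) (·-zeroʳ a))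

    oe : Words₁ a e f 0ⱽ 0ⱽ 0ⱽ 0ⱽ
    oe = words₁ ≋-refl xf ae (⊞-null (·-zeroʳ x) af) (⊞-null (·-zeroʳ x) (·-zeroʳ a))

    ce+bf : c · e ⊞ b · f ≋ 0ⱽ
    ce+bf = ≋-trans (≋-sym (⊞-nullʳ (·-zeroʳ x) (⊞-nullʳ (·-zeroʳ a) ≋-refl))) (cubic₀ px pe)

    ce-bf : c · e ⊞ ι -1ℚ ⋆ (b · f) ≋ 0ⱽ
    ce-bf = ≋-trans (≋-sym (⊞-nullʳ (·-zeroʳ x) (⊞-nullʳ (·-zeroʳ a) (⊞-cong
        (⊞-nullʳ (·-zeroʳ b) (⊞-nullʳ (·-zeroʳ _) (·-comm e c))) (·-⋆ b (ι -1ℚ) f))))) (cubic₁ ox oc)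

    ce : c · e ≋ 0ⱽ
    ce i = vanish (½ ⊙ ce+bf i ⊕ ½ ⊙ ce-bf i)
      (solve 2 (λ p q → p := con ½ :* (p :+ q) :+ con ½ :* (p :+ con -1ℚ :* q)) refl _ _)

    bf : b · f ≋ 0ⱽ
    bf = ≋-trans (≋-sym (⊞-nullˡ ce ≋-refl)) ce+bf

    de : d · e ≋ 0ⱽ
    de i = vanish (½ ⊙ substitute (cubic₁ ox od)
        (·-comm e d ∙ ≋-trans (⊞-· _ _ _) (⊞-nullˡ ce ≋-refl) ∙ hat bf ∙ hat (⋆-null bf)
          ∙ hat (·-zeroʳ a) ∙ hat (·-zeroʳ x)) i)
      (solve 1 (λ p → p := con ½ :* (p :+ p :+ con 0ℚ :+ con 0ℚ :+ con 0ℚ :+ con 0ℚ)) refl _)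

    cf : c · f ≋ 0ⱽ
    cf = ≋-trans (≋-sym (⊞-nullʳ (·-zeroʳ a) (⊞-nullʳ (·-zeroʳ b) (⊞-nullˡ (·-zeroˡ e) ≋-refl)))) (cubic₀ pa pe)

    df : d · f ≋ 0ⱽ
    -- The first and third terms contribute -3 and -2 times `d · f`, whence the factor `-⅕`.
    df i = vanish (-⅕ ⊙ substitute (cubic₂ ox₂ od₂)
        (≋-trans (⋆-· _ _ _) (⋆-cong (·-comm f d)) ∙ hat (·-zeroˡ e)
          ∙ ≋-trans (·-⋆ _ _ _) (⋆-cong (≋-trans (⊞-· _ _ _) (⊞-nullˡ cf ≋-refl)))
          ∙ hat (·-zeroʳ b) ∙ hat (·-zeroʳ a) ∙ hat (·-zeroʳ x)) i)
      (solve 1 (λ p → p := con -⅕ :*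
        (con -3ℚ :* p :+ con 0ℚ :+ con -2ℚ :* p :+ con 0ℚ :+ con 0ℚ :+ con 0ℚ)) refl _)

    ee : e · e ≋ 0ⱽ
    ee = ≋-trans (≋-sym (⊞-nullʳ (·-zeroʳ x) (⊞-nullʳ (·-zeroʳ a) (⊞-nullʳ (·-zeroʳ b)
      (⊞-nullʳ (·-zeroʳ b) (⊞-nullʳ (≋-trans (⊞-· _ _ _) (⊞-null cf df)) ≋-refl)))))) (cubic₁ ox oe)

    ef : e · f ≋ 0ⱽ
    ef i = vanish (½ ⊙ substitute (cubic₀ pd pd)
        (hat (·-zeroˡ d) ∙ ·-comm f e ∙ ≋-refl ∙ hat (·-zeroʳ d)) i)
      (solve 1 (λ p → p := con ½ :* (con 0ℚ :+ p :+ p :+ con 0ℚ)) refl _)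

    ff : f · f ≋ 0ⱽ
    ff = ≋-trans (≋-sym (⊞-nullʳ (·-zeroʳ d) (⊞-nullʳ (·-zeroʳ e) (⊞-nullˡ (·-zeroˡ e) ≋-refl)))) (cubic₀ pd pe)

-- Rational coordinates in this subalgebra, and the inverse computed with them.

Coordinates : Set
Coordinates = Vec ℚ 7

zeros : ∀ {k} → Vec ℚ k
zeros = Vec.replicate _ 0ℚ

unit : ∀ {k} → Fin k → Vec ℚ k
unit zero    = 1ℚ ∷ zeros
unit (suc i) = 0ℚ ∷ unit i

â b̂ ĉ d̂ ê f̂ : Coordinates
â = unit (# 1)
b̂ = unit (# 2)
ĉ = unit (# 3)
d̂ = unit (# 4)
ê = unit (# 5)
f̂ = unit (# 6)

infixl 6 _⊞ᶜ_
infixr 8 _⋆ᶜ_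
infixr 7 _·ᶜ_

_⊞ᶜ_ : Coordinates → Coordinates → Coordinates
_⊞ᶜ_ = Vec.zipWith ℚ._+_

_⋆ᶜ_ : ℚ → Coordinates → Coordinates
q ⋆ᶜ m = Vec.map (q ℚ.*_) m

combine : ∀ {k} → Vec ℚ k → Vec Coordinates k → Coordinates
combine []       []       = zeros
combine (q ∷ qs) (m ∷ ms) = q ⋆ᶜ m ⊞ᶜ combine qs ms

-- Rows and columns follow the order x, a, b, c, d, e, f; `rows` justifies the entries. All data are
-- closed rationals, so `_·ᶜ_` evaluates and equations between coordinates hold by `≡.refl`.
table : Vec (Vec Coordinates 7) 7
table =
  (â     ∷ b̂     ∷ ĉ          ∷ zeros      ∷ ê          ∷ f̂     ∷ zeros ∷ []) ∷
  (b̂     ∷ d̂     ∷ zeros      ∷ -1ℚ ⋆ᶜ f̂   ∷ -2ℚ ⋆ᶜ f̂   ∷ zeros ∷ zeros ∷ []) ∷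
  (ĉ     ∷ zeros ∷ 2ℚ ⋆ᶜ f̂    ∷ zeros      ∷ zeros      ∷ zeros ∷ zeros ∷ []) ∷
  (zeros ∷ -1ℚ ⋆ᶜ f̂ ∷ zeros   ∷ zeros      ∷ zeros      ∷ zeros ∷ zeros ∷ []) ∷
  (ê     ∷ -2ℚ ⋆ᶜ f̂ ∷ zeros   ∷ zeros      ∷ zeros      ∷ zeros ∷ zeros ∷ []) ∷
  (f̂     ∷ zeros ∷ zeros      ∷ zeros      ∷ zeros      ∷ zeros ∷ zeros ∷ []) ∷
  (zeros ∷ zeros ∷ zeros      ∷ zeros      ∷ zeros      ∷ zeros ∷ zeros ∷ []) ∷ []

_·ᶜ_ : Coordinates → Coordinates → Coordinates
m ·ᶜ m′ = combine m (Vec.map (combine m′) table)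

module Inverse {κ ℓ} {A : Commutativeℚ-Algebra κ ℓ} {n : ℕ} (L : NilAlgebra A n) where
  open Vectors A n
  open NilAlgebra L
  open NilAlgebraProperties L
  open OneGenerator L

  -- The solution of G = x + ½ G · G degree by degree: N₂ = x N₁, N₃ = x N₂ + ½ N₁ N₁, and N₄ = x N₃
  -- + N₁ N₂, where `xc` and `ab` leave only the term with `x · d`.
  N₁ N₂ N₃ N₄ inverse : V → V
  N₁ x = ι ½ ⋆ (x · x)
  N₂ x = ι ½ ⋆ (x · x · x)
  N₃ x = ι ½ ⋆ (x · x · x · x) ⊞ ι ⅛ ⋆ ((x · x) · (x · x))
  N₄ x = ι ⅛ ⋆ (x · (x · x) · (x · x))
  inverse x = x ⊞ N₁ x ⊞ N₂ x ⊞ N₃ x ⊞ N₄ x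

  inverse-cong : ∀ {u v} → u ≋ v → inverse u ≋ inverse v
  inverse-cong p = ⊞-cong (⊞-cong (⊞-cong (⊞-cong p (⋆-cong p²)) (⋆-cong (·-cong p p²)))
      (⊞-cong (⋆-cong (·-cong p (·-cong p p²))) (⋆-cong (·-cong p² p²)))) (⋆-cong (·-cong p (·-cong p² p²)))
    where p² = ·-cong p p

  lin : ∀ {k} → Vec ℚ k → Vec V k → V
  lin []       []       = 0̂
  lin (q ∷ qs) (u ∷ us) = ι q ⋆ u ⊞ lin qs us

  lin-· : ∀ {k} (qs : Vec ℚ k) us v → lin qs us · v ≋ lin qs (Vec.map (_· v) us)
  lin-· []       []       v = ≋-trans (·-comm _ _) (·-0̂ 0# v)
  lin-· (q ∷ qs) (u ∷ us) v = ≋-trans (⊞-· _ _ _) (⊞-cong (⋆-· _ _ _) (lin-· qs us v))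

  ·-lin : ∀ {k} v (qs : Vec ℚ k) us → v · lin qs us ≋ lin qs (Vec.map (v ·_) us)
  ·-lin v []       []       = ·-0̂ 0# v
  ·-lin v (q ∷ qs) (u ∷ us) = ≋-trans (·-⊞ _ _ _) (⊞-cong (·-⋆ _ _ _) (·-lin v qs us))

  lin-⊞ : ∀ {k} (us : Vec V k) ps qs → lin (Vec.zipWith ℚ._+_ ps qs) us ≋ lin ps us ⊞ lin qs us
  lin-⊞ []       []       []       i = solve 0 (con 0ℚ := con 0ℚ :+ con 0ℚ) refl
  lin-⊞ (u ∷ us) (p ∷ ps) (q ∷ qs) i = trans (+-cong (*-congʳ (+-homo p q)) (lin-⊞ us ps qs i))
    (solve 5 (λ p q u v w → (p :+ q) :* u :+ (v :+ w) := (p :* u :+ v) :+ (q :* u :+ w)) refl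
      (ι p) (ι q) (u i) _ _)

  lin-⋆ : ∀ {k} (us : Vec V k) q ps → lin (Vec.map (q ℚ.*_) ps) us ≋ ι q ⋆ lin ps us
  lin-⋆ []       q []       i = solve 1 (λ q → con 0ℚ := q :* con 0ℚ) refl (ι q)
  lin-⋆ (u ∷ us) q (p ∷ ps) i = trans (+-cong (*-congʳ (*-homo q p)) (lin-⋆ us q ps i))
    (solve 4 (λ q p u v → (q :* p) :* u :+ q :* v := q :* (p :* u :+ v)) refl (ι q) (ι p) (u i) _)

  lin-zeros : ∀ {k} (us : Vec V k) → lin zeros us ≋ 0ⱽ
  lin-zeros []       = 0̂≋0
  lin-zeros (u ∷ us) i = trans (+-cong (trans (*-congʳ 0#-homo) (zeroˡ (u i))) (lin-zeros us i)) (+-identityˡ 0#)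

  lin-unit : ∀ {k} (us : Vec V k) j → lin (unit j) us ≋ Vec.lookup us j
  lin-unit (u ∷ us) zero    i =
    trans (+-cong (trans (*-congʳ 1#-homo) (*-identityˡ (u i))) (lin-zeros us i)) (+-identityʳ (u i))
  lin-unit (u ∷ us) (suc j) i =
    trans (+-cong (trans (*-congʳ 0#-homo) (zeroˡ (u i))) (lin-unit us j i)) (+-identityˡ _)

  module _ (x : V) where
    basis : Vec V 7
    basis = x ∷ a x ∷ b x ∷ c x ∷ d x ∷ e x ∷ f x ∷ []

    ⟦_⟧ : Coordinates → V
    ⟦ m ⟧ = lin m basis

    -- The seven vectors may be linearly dependent, so coordinates only certify equalities and are
    -- not a function of the vector. The record wrapper keeps `m` inferable although `⟦_⟧` unfolds.
    record Represents (v : V) (m : Coordinates) : Set ℓ where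
      constructor represents
      field value : v ≋ ⟦ m ⟧

    resp : ∀ {u v m} → u ≋ v → Represents v m → Represents u m
    resp p (represents q) = represents (≋-trans p q)

    null : ∀ {v} → v ≋ 0ⱽ → Represents v zeros
    null p = represents (≋-trans p (≋-sym (lin-zeros basis)))

    basic : ∀ j → Represents (Vec.lookup basis j) (unit j)
    basic j = represents (≋-sym (lin-unit basis j))

    infixl 6 _⊞ʳ_
    infixr 8 _⋆ʳ_

    _⊞ʳ_ : ∀ {u v m m′} → Represents u m → Represents v m′ → Represents (u ⊞ v) (m ⊞ᶜ m′)
    _⊞ʳ_ {m = m} {m′} (represents p) (represents q) =
      represents (≋-trans (⊞-cong p q) (≋-sym (lin-⊞ basis m m′)))

    _⋆ʳ_ : ∀ q {u m} → Represents u m → Represents (ι q ⋆ u) (q ⋆ᶜ m)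
    _⋆ʳ_ q {m = m} (represents p) = represents (≋-trans (⋆-cong p) (≋-sym (lin-⋆ basis q m)))

    flip : ∀ {u v m} → Represents (u · v) m → Represents (v · u) m
    flip p = resp (·-comm _ _) p

    represents-combine : ∀ {k} (qs : Vec ℚ k) {us ms} →
      Pointwise Represents us ms → Represents (lin qs us) (combine qs ms)
    represents-combine []       []       = null 0̂≋0
    represents-combine (q ∷ qs) (r ∷ rs) = q ⋆ʳ r ⊞ʳ represents-combine qs rs

    rows : Pointwise (λ u ms → Pointwise Represents (Vec.map (u ·_) basis) ms) basis table
    rows =
      (xx ∷ xb′ ∷ xc′ ∷ null (xc x) ∷ xd ∷ xe ∷ null (xf x) ∷ []) ∷
      (flip xb′ ∷ aa ∷ null (ab x) ∷ ac′ ∷ ad′ ∷ null (ae x) ∷ null (af x) ∷ []) ∷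
      (flip xc′ ∷ flip (null (ab x)) ∷ resp (bb x) (2ℚ ⋆ʳ basic (# 6)) ∷ null (bc x) ∷ null (bd x)
        ∷ null (be x) ∷ null (bf x) ∷ []) ∷
      (flip (null (xc x)) ∷ flip ac′ ∷ flip (null (bc x)) ∷ null (cc x) ∷ flip (null (dc x))
        ∷ null (ce x) ∷ null (cf x) ∷ []) ∷
      (flip xd ∷ flip ad′ ∷ flip (null (bd x)) ∷ null (dc x) ∷ null (dd x) ∷ null (de x)
        ∷ null (df x) ∷ []) ∷
      (flip xe ∷ flip (null (ae x)) ∷ flip (null (be x)) ∷ flip (null (ce x)) ∷ flip (null (de x))
        ∷ null (ee x) ∷ null (ef x) ∷ []) ∷
      (flip (null (xf x)) ∷ flip (null (af x)) ∷ flip (null (bf x)) ∷ flip (null (cf x))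
        ∷ flip (null (df x)) ∷ flip (null (ef x)) ∷ null (ff x) ∷ []) ∷ []
      where
      xx  = basic (# 1)
      xb′ = basic (# 2)
      xc′ = basic (# 3)
      aa  = basic (# 4)
      xd  = basic (# 5)
      xe  = basic (# 6)
      ac′ = resp (ac x) (-1ℚ ⋆ʳ basic (# 6))
      ad′ = resp (ad x) (-2ℚ ⋆ʳ basic (# 6))

    ·-represents : ∀ m m′ → Represents (⟦ m ⟧ · ⟦ m′ ⟧) (m ·ᶜ m′)
    ·-represents m m′ = resp (lin-· m basis ⟦ m′ ⟧) (represents-combine m (columns rows))
      where
      columns : ∀ {k} {us : Vec V k} {mss : Vec (Vec Coordinates 7) k} →
        Pointwise (λ u ms → Pointwise Represents (Vec.map (u ·_) basis) ms) us mss →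
        Pointwise Represents (Vec.map (_· ⟦ m′ ⟧) us) (Vec.map (combine m′) mss)
      columns []                    = []
      columns {us = u ∷ _} (r ∷ rs) =
        resp (·-lin u m′ basis) (represents-combine m′ r) ∷ columns rs

    infixr 7 _·ʳ_
    _·ʳ_ : ∀ {u v m m′} → Represents u m → Represents v m′ → Represents (u · v) (m ·ᶜ m′)
    _·ʳ_ {m = m} {m′} (represents p) (represents q) = resp (·-cong p q) (·-represents m m′)

    convert : ∀ {v m m′} → m ≡ m′ → Represents v m → Represents v m′
    convert ≡.refl p = p

    represents-unique : ∀ {u v m} → Represents u m → Represents v m → u ≋ v
    represents-unique (represents p) (represents q) = ≋-trans p (≋-sym q)

    -- The decisive cancellation is in the coordinate at `f` of half the square, where `x · e`,
    -- `a · c`, `a · d` and `b · b` contribute ⅛, -¼, -⅛ and ¼.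
    inverse-right : inverse x ⊞ ι -½ ⋆ (inverse x · inverse x) ≋ x
    inverse-right = represents-unique (convert ≡.refl (g ⊞ʳ -½ ⋆ʳ (g ·ʳ g))) (basic (# 0))
      where
      g : Represents (inverse x) (1ℚ ∷ ½ ∷ ½ ∷ ½ ∷ ⅛ ∷ ⅛ ∷ 0ℚ ∷ [])
      g = convert ≡.refl (basic (# 0) ⊞ʳ ½ ⋆ʳ basic (# 1) ⊞ʳ ½ ⋆ʳ basic (# 2)
        ⊞ʳ (½ ⋆ʳ basic (# 3) ⊞ʳ ⅛ ⋆ʳ basic (# 4)) ⊞ʳ ⅛ ⋆ʳ basic (# 5))

    inverse-left : inverse (x ⊞ ι -½ ⋆ (x · x)) ≋ x
    inverse-left = represents-unique (convert ≡.refl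
        (y ⊞ʳ ½ ⋆ʳ y² ⊞ʳ ½ ⋆ʳ y³ ⊞ʳ (½ ⋆ʳ y⁴ ⊞ʳ ⅛ ⋆ʳ y²y²) ⊞ʳ ⅛ ⋆ʳ convert ≡.refl (y ·ʳ y²y²)))
      (basic (# 0))
      where
      -- Coordinates of the powers of x - ½ a, recorded so that each product starts from evaluated
      -- rationals. The product is not associative, so `ŷ⁴` (from y · y³) and `ŷ²ŷ²` differ.
      ŷ ŷ² ŷ³ ŷ⁴ ŷ²ŷ² : Coordinates
      ŷ    = 1ℚ ∷ -½  ∷ 0ℚ  ∷ 0ℚ  ∷ 0ℚ ∷ 0ℚ ∷ 0ℚ   ∷ []
      ŷ²   = 0ℚ ∷ 1ℚ  ∷ -1ℚ ∷ 0ℚ  ∷ ¼  ∷ 0ℚ ∷ 0ℚ   ∷ []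
      ŷ³   = 0ℚ ∷ 0ℚ  ∷ 1ℚ  ∷ -1ℚ ∷ -½ ∷ ¼  ∷ ¼    ∷ []
      ŷ⁴   = 0ℚ ∷ 0ℚ  ∷ 0ℚ  ∷ 1ℚ  ∷ 0ℚ ∷ -½ ∷ -¾   ∷ []
      ŷ²ŷ² = 0ℚ ∷ 0ℚ  ∷ 0ℚ  ∷ 0ℚ  ∷ 1ℚ ∷ 0ℚ ∷ 1ℚ   ∷ []
      y : Represents (x ⊞ ι -½ ⋆ (x · x)) ŷ
      y = convert ≡.refl (basic (# 0) ⊞ʳ -½ ⋆ʳ basic (# 1))
      y² = convert {m′ = ŷ²} ≡.refl (y ·ʳ y)
      y³ = convert {m′ = ŷ³} ≡.refl (y ·ʳ y²)
      y⁴ = convert {m′ = ŷ⁴} ≡.refl (y ·ʳ y³)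
      y²y² = convert {m′ = ŷ²ŷ²} ≡.refl (y² ·ʳ y²)

-- Polynomial substitution and directional derivatives.

⌊suc≟suc⌋ : ∀ {n} (i j : Fin n) → ⌊ suc i ≟ suc j ⌋ ≡ ⌊ i ≟ j ⌋
⌊suc≟suc⌋ i j with i ≟ j
... | yes _ = ≡.refl
... | no  _ = ≡.refl

⌊≟⌋-sym : ∀ {n} (i j : Fin n) → ⌊ i ≟ j ⌋ ≡ ⌊ j ≟ i ⌋
⌊≟⌋-sym i j with i ≟ j | j ≟ i
... | yes _   | yes _   = ≡.refl
... | no  _   | no  _   = ≡.refl
... | yes i≡j | no  j≢i = contradiction (≡.sym i≡j) j≢i
... | no  i≢j | yes j≡i = contradiction (≡.sym j≡i) i≢j

module _ {c ℓ} (K : Commutativeℚ-Algebra c ℓ) where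
  private module K = Scalars K
  open Polynomials K.commutativeRing

  polyAlgebra : ℕ → Commutativeℚ-Algebra c (c ⊔ ℓ)
  polyAlgebra n = record
    { commutativeRing    = polyRing n
    ; structureMap       = λ q → con (K.ι q)
    ; isRingHomomorphism = record
      { isSemiringHomomorphism = record
        { isNearSemiringHomomorphism = record
          { +-isMonoidHomomorphism = record
            { isMagmaHomomorphism = record
              { isRelHomomorphism = record { cong = λ { ≡.refl → ≈-refl } }
              ; homo = λ p q → ≈-trans (con-cong (K.+-homo p q)) (con-+ _ _) }
            ; ε-homo = con-cong K.0#-homo }
          ; *-homo = λ p q → ≈-trans (con-cong (K.*-homo p q)) (con-* _ _) }
        ; 1#-homo = con-cong K.1#-homo }
      -- The congruence has no rule for `con` of a negative; uniqueness of additive inverses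
      -- supplies it.
      ; -‿homo = λ p → uniqueˡ _ _ (≈-trans (≈-sym (con-+ _ _))
          (con-cong (K.trans (K.+-congʳ (K.-‿homo p)) (K.-‿inverseˡ _)))) } }
    where open RingProperties (CommutativeRing.ring (polyRing n)) using () renaming (+-inverseˡ-unique to uniqueˡ)

module Substitution {c ℓ} (K : Commutativeℚ-Algebra c ℓ) where
  private module K = Scalars K
  open Polynomials K.commutativeRing

  []-cong : ∀ {m n} {p q : Poly m} {u : Vector (Poly n) m} → p ≈ q → p [ u ] ≈ q [ u ]
  []-cong ≈-refl              = ≈-refl
  []-cong (≈-sym e)           = ≈-sym ([]-cong e)
  []-cong (≈-trans e e′)      = ≈-trans ([]-cong e) ([]-cong e′)
  []-cong (+-cong e e′)       = +-cong ([]-cong e) ([]-cong e′)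
  []-cong (*-cong e e′)       = *-cong ([]-cong e) ([]-cong e′)
  []-cong (neg-cong e)        = neg-cong ([]-cong e)
  []-cong (+-assoc p q r)     = +-assoc _ _ _
  []-cong (+-comm p q)        = +-comm _ _
  []-cong (+-identityˡ p)     = +-identityˡ _
  []-cong (+-inverseˡ p)      = +-inverseˡ _
  []-cong (*-assoc p q r)     = *-assoc _ _ _
  []-cong (*-comm p q)        = *-comm _ _
  []-cong (*-identityˡ p)     = *-identityˡ _
  []-cong (*-distribʳ p q r)  = *-distribʳ _ _ _
  []-cong (con-cong e)        = con-cong e
  []-cong (con-+ a b)         = con-+ a b
  []-cong (con-* a b)         = con-* a b

  []-congʳ : ∀ {m n} (p : Poly m) {u v : Vector (Poly n) m} → (∀ i → u i ≈ v i) → p [ u ] ≈ p [ v ]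
  []-congʳ (con a) e = ≈-refl
  []-congʳ (var i) e = e i
  []-congʳ (p + q) e = +-cong ([]-congʳ p e) ([]-congʳ q e)
  []-congʳ (p * q) e = *-cong ([]-congʳ p e) ([]-congʳ q e)
  []-congʳ (- p)   e = neg-cong ([]-congʳ p e)

  []-∘ : ∀ {l m n} (p : Poly l) (u : Vector (Poly m) l) (v : Vector (Poly n) m) →
    p [ u ] [ v ] ≡ p [ (λ i → u i [ v ]) ]
  []-∘ (con a) u v = ≡.refl
  []-∘ (var i) u v = ≡.refl
  []-∘ (p + q) u v = ≡.cong₂ _+_ ([]-∘ p u v) ([]-∘ q u v)
  []-∘ (p * q) u v = ≡.cong₂ _*_ ([]-∘ p u v) ([]-∘ q u v)
  []-∘ (- p)   u v = ≡.cong -_ ([]-∘ p u v)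

  []-var : ∀ {n} (p : Poly n) → p [ var ] ≡ p
  []-var (con a) = ≡.refl
  []-var (var i) = ≡.refl
  []-var (p + q) = ≡.cong₂ _+_ ([]-var p) ([]-var q)
  []-var (p * q) = ≡.cong₂ _*_ ([]-var p) ([]-var q)
  []-var (- p)   = ≡.cong -_ ([]-var p)

  ∑-[] : ∀ {n k} m (f : Vector (Poly n) m) (u : Vector (Poly k) n) →
    ∑ m f [ u ] ≡ ∑ m (λ i → f i [ u ])
  ∑-[] zero    f u = ≡.refl
  ∑-[] (suc m) f u = ≡.cong (f zero [ u ] +_) (∑-[] m (λ i → f (suc i)) u)

  -- The derivative of a polynomial at the point `u` in direction `v`; `D-∑` relates it to the
  -- partial derivatives. Recursion on the polynomial makes it commute with substitution up to
  -- `_≡_`, see `D-[]`.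
  D : ∀ {m n} → Poly m → Vector (Poly n) m → Vector (Poly n) m → Poly n
  D (con a) u v = 0#
  D (var i) u v = v i
  D (p + q) u v = D p u v + D q u v
  D (p * q) u v = D p u v * q [ u ] + p [ u ] * D q u v
  D (- p)   u v = - D p u v

  D-[] : ∀ {l m n} (p : Poly l) (u v : Vector (Poly m) l) (w : Vector (Poly n) m) →
    D p u v [ w ] ≡ D p (λ i → u i [ w ]) (λ i → v i [ w ])
  D-[] (con a) u v w = ≡.refl
  D-[] (var i) u v w = ≡.refl
  D-[] (p + q) u v w = ≡.cong₂ _+_ (D-[] p u v w) (D-[] q u v w)
  D-[] (p * q) u v w = ≡.cong₂ _+_ (≡.cong₂ _*_ (D-[] p u v w) ([]-∘ q u w))
    (≡.cong₂ _*_ ([]-∘ p u w) (D-[] q u v w))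
  D-[] (- p)   u v w = ≡.cong -_ (D-[] p u v w)

  module Derivative {m n : ℕ} where
    private
      W : Set c
      W = Vector (Poly n) m
    open Vectors (polyAlgebra K n) n using
      ( solve; _:+_; _:*_; :-_; _:=_; zeroˡ; zeroʳ; *-identityʳ; +-identityʳ; *-congˡ
      ; *-congʳ; sum-cong-≋; ∑-distrib-+; *-distribˡ-sum; *-distribʳ-sum
      ; sum-replicate-zero; distribˡ; reflexive )
      renaming (con to :con)

    D-congʳ : ∀ (p : Poly m) {u u′ v v′ : W} → (∀ i → u i ≈ u′ i) → (∀ i → v i ≈ v′ i) → D p u v ≈ D p u′ v′
    D-congʳ (con a) e f = ≈-refl
    D-congʳ (var i) e f = f i
    D-congʳ (p + q) e f = +-cong (D-congʳ p e f) (D-congʳ q e f)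
    D-congʳ (p * q) e f = +-cong (*-cong (D-congʳ p e f) ([]-congʳ q e)) (*-cong ([]-congʳ p e) (D-congʳ q e f))
    D-congʳ (- p)   e f = neg-cong (D-congʳ p e f)

    D-cong : ∀ {p q : Poly m} {u v : W} → p ≈ q → D p u v ≈ D q u v
    D-cong ≈-refl             = ≈-refl
    D-cong (≈-sym e)          = ≈-sym (D-cong e)
    D-cong (≈-trans e e′)     = ≈-trans (D-cong e) (D-cong e′)
    D-cong (+-cong e e′)      = +-cong (D-cong e) (D-cong e′)
    D-cong (*-cong e e′)      = +-cong (*-cong (D-cong e) ([]-cong e′)) (*-cong ([]-cong e) (D-cong e′))
    D-cong (neg-cong e)       = neg-cong (D-cong e)
    D-cong (+-assoc p q r)    = +-assoc _ _ _
    D-cong (+-comm p q)       = +-comm _ _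
    D-cong (+-identityˡ p)    = +-identityˡ _
    D-cong (+-inverseˡ p)     = +-inverseˡ _
    D-cong (*-assoc p q r)    = solve 6 (λ p q r p′ q′ r′ →
      (p′ :* q :+ p :* q′) :* r :+ (p :* q) :* r′ := p′ :* (q :* r) :+ p :* (q′ :* r :+ q :* r′)) ≈-refl _ _ _ _ _ _
    D-cong (*-comm p q)       = solve 4 (λ p q p′ q′ → p′ :* q :+ p :* q′ := q′ :* p :+ q :* p′) ≈-refl _ _ _ _
    D-cong (*-identityˡ p)    = ≈-trans (+-cong (zeroˡ _) (*-identityˡ _)) (+-identityˡ _)
    D-cong (*-distribʳ p q r) = solve 6 (λ p q r p′ q′ r′ →
      (q′ :+ r′) :* p :+ (q :+ r) :* p′ := (q′ :* p :+ q :* p′) :+ (r′ :* p :+ r :* p′)) ≈-refl _ _ _ _ _ _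
    D-cong (con-cong e)       = ≈-refl
    D-cong (con-+ a b)        = ≈-sym (+-identityˡ _)
    D-cong (con-* a b)        = ≈-sym (≈-trans (+-cong (zeroˡ _) (zeroʳ _)) (+-identityˡ _))

    D-+ : ∀ (p : Poly m) (u v w : W) → D p u (λ i → v i + w i) ≈ D p u v + D p u w
    D-+ (con a) u v w = ≈-sym (+-identityˡ _)
    D-+ (var i) u v w = ≈-refl
    D-+ (p + q) u v w = ≈-trans (+-cong (D-+ p u v w) (D-+ q u v w))
      (solve 4 (λ a b c d → (a :+ b) :+ (c :+ d) := (a :+ c) :+ (b :+ d)) ≈-refl _ _ _ _)
    D-+ (p * q) u v w = ≈-trans (+-cong (*-congʳ (D-+ p u v w)) (*-congˡ (D-+ q u v w)))
      (solve 6 (λ a b c d p q → (a :+ b) :* q :+ p :* (c :+ d) := (a :* q :+ p :* c) :+ (b :* q :+ p :* d)) ≈-refl _ _ _ _ _ _)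
    D-+ (- p)   u v w = ≈-trans (neg-cong (D-+ p u v w)) (solve 2 (λ a b → :- (a :+ b) := :- a :+ :- b) ≈-refl _ _)

    D-* : ∀ (p : Poly m) (u : W) r (v : W) → D p u (λ i → r * v i) ≈ r * D p u v
    D-* (con a) u r v = ≈-sym (zeroʳ r)
    D-* (var i) u r v = ≈-refl
    D-* (p + q) u r v = ≈-trans (+-cong (D-* p u r v) (D-* q u r v)) (≈-sym (distribˡ _ _ _))
    D-* (p * q) u r v = ≈-trans (+-cong (*-congʳ (D-* p u r v)) (*-congˡ (D-* q u r v)))
      (solve 5 (λ r a b p q → (r :* a) :* q :+ p :* (r :* b) := r :* (a :* q :+ p :* b)) ≈-refl _ _ _ _ _)
    D-* (- p)   u r v = ≈-trans (neg-cong (D-* p u r v)) (solve 2 (λ r a → :- (r :* a) := r :* (:- a)) ≈-refl _ _)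

    ∑-0 : ∀ k {f : Vector (Poly n) k} → (∀ i → f i ≈ 0#) → ∑ k f ≈ 0#
    ∑-0 k e = ≈-trans (sum-cong-≋ {k} e) (sum-replicate-zero k)

    -- The substitution stays in the statement because `if` does not reduce while the comparison is
    -- undecided. The delta arises both from `∂ i (var j)` and from `identityᴹ`.
    ∑-δ : ∀ {l} (u : Vector (Poly n) l) {k} (j : Fin k) (v : Vector (Poly n) k) →
      ∑ k (λ i → (if ⌊ i ≟ j ⌋ then 1# {l} else 0#) [ u ] * v i) ≈ v j
    ∑-δ u {suc k} zero    v = ≈-trans (+-cong (*-identityˡ _) (∑-0 k (λ i → zeroˡ _))) (+-identityʳ _)
    ∑-δ {l} u {suc k} (suc j) v = ≈-trans (+-cong (zeroˡ _)
      (≈-trans (sum-cong-≋ {k} (λ i → *-congʳ (reflexive (≡.cong (λ b → (if b then 1# {l} else 0#) [ u ]) (⌊suc≟suc⌋ i j)))))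
        (∑-δ u j (λ i → v (suc i))))) (+-identityˡ _)

    D-∑ : ∀ (p : Poly m) (u v : W) → D p u v ≈ ∑ m (λ k → ∂ k p [ u ] * v k)
    D-∑ (con a) u v = ≈-sym (∑-0 m (λ k → zeroˡ (v k)))
    D-∑ (var j) u v = ≈-sym (∑-δ u j v)
    D-∑ (p + q) u v = ≈-trans (+-cong (D-∑ p u v) (D-∑ q u v)) (≈-sym (≈-trans
      (sum-cong-≋ {m} (λ k → *-distribʳ (v k) _ _)) (∑-distrib-+ {m} _ _)))
    D-∑ (p * q) u v = ≈-trans
      (+-cong (≈-trans (*-congʳ (D-∑ p u v)) (*-distribʳ-sum {m} _ _))
        (≈-trans (*-congˡ (D-∑ q u v)) (*-distribˡ-sum {m} _ _)))
      (≈-trans (≈-sym (∑-distrib-+ {m} _ _)) (sum-cong-≋ {m} (λ k →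
        solve 5 (λ a b p q v → (a :* v) :* q :+ p :* (b :* v) := (a :* q :+ p :* b) :* v) ≈-refl
          (∂ k p [ u ]) (∂ k q [ u ]) (p [ u ]) (q [ u ]) (v k))))
    D-∑ (- p)   u v = ≈-trans (neg-cong (D-∑ p u v)) (≈-trans
      (solve 1 (λ s → :- s := :con -1ℚ :* s) ≈-refl _) (≈-trans (*-distribˡ-sum {m} _ _)
      (sum-cong-≋ {m} (λ k → solve 2 (λ a v → :con -1ℚ :* (a :* v) := (:- a) :* v) ≈-refl (∂ k p [ u ]) (v k)))))

    D-term : ∀ a i j (u v : W) → D (con a * ⟦ i ∷ j ∷ [] ⟧ᵐ) u v ≈ con a * (v i * u j + u i * v j)
    D-term a i j u v = ≈-trans
      -- Here `o` and `e` stand for the `0#` and `1#` left by differentiating constants; the right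
      -- side collects the multiples of `o`, to be dropped next.
      (solve 7 (λ a o e ui uj vi vj →
          o :* (ui :* (uj :* e)) :+ a :* (vi :* (uj :* e) :+ ui :* (vj :* e :+ uj :* o)) :=
          o :* (ui :* (uj :* e) :+ a :* (ui :* uj)) :+ (a :* (vi :* uj :+ ui :* vj)) :* e)
        ≈-refl (con a) 0# 1# (u i) (u j) (v i) (v j))
      (≈-trans (+-cong (zeroˡ _) (*-identityʳ _)) (+-identityˡ _))

    -- For quadratic `p` the derivative is the polar form, a symmetric bilinear form; by linearity,
    -- monomials of length two suffice.
    D-comm : ∀ {p : Poly m} → Homogeneous 2 p → ∀ (u v : W) → D p u v ≈ D p v u
    D-comm zeroˢ         u v = ≈-refl
    D-comm (termˢ a {i ∷ j ∷ []} ≡.refl) u v = ≈-trans (D-term a i j u v) (≈-trans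
      (solve 5 (λ a ui uj vi vj → a :* (vi :* uj :+ ui :* vj) := a :* (ui :* vj :+ vi :* uj)) ≈-refl _ _ _ _ _)
      (≈-sym (D-term a i j v u)))
    D-comm (plusˢ h k)   u v = +-cong (D-comm h u v) (D-comm k u v)
    D-comm (respˢ e h)   u v = ≈-trans (D-cong (≈-sym e)) (≈-trans (D-comm h u v) (D-cong e))

    -- Euler's identity in degree 2, again checked on monomials.
    D-diagonal : ∀ {p : Poly m} → Homogeneous 2 p → ∀ (u : W) → D p u u ≈ p [ u ] + p [ u ]
    D-diagonal zeroˢ         u = ≈-sym (+-identityˡ _)
    D-diagonal (termˢ a {i ∷ j ∷ []} ≡.refl) u = ≈-trans (D-term a i j u u) (≈-trans
      (solve 3 (λ a ui uj → a :* (ui :* uj :+ ui :* uj) := a :* (ui :* uj) :+ a :* (ui :* uj)) ≈-refl _ _ _)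
      (+-cong (*-congˡ (*-congˡ (≈-sym (*-identityʳ _)))) (*-congˡ (*-congˡ (≈-sym (*-identityʳ _))))))
    D-diagonal (plusˢ h k)   u = ≈-trans (+-cong (D-diagonal h u) (D-diagonal k u))
      (solve 2 (λ p q → (p :+ p) :+ (q :+ q) := (p :+ q) :+ (p :+ q)) ≈-refl _ _)
    D-diagonal (respˢ e h)   u = ≈-trans (D-cong (≈-sym e)) (≈-trans (D-diagonal h u) (+-cong ([]-cong e) ([]-cong e)))

    D-homogeneous : ∀ {p : Poly m} {d e} → Homogeneous 2 p → ∀ {u v : W} →
      (∀ i → Homogeneous d (u i)) → (∀ i → Homogeneous e (v i)) → Homogeneous (d ℕ.+ e) (D p u v)
    D-homogeneous zeroˢ g h = zeroˢ
    D-homogeneous {d = d} {e} (termˢ a {i ∷ j ∷ []} ≡.refl) {u} {v} g h = respˢ (≈-sym (D-term a i j u v))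
      (homogeneous-* (homogeneous-con a) (plusˢ
        (≡.subst (λ k → Homogeneous k (v i * u j)) (ℕ.+-comm e d) (homogeneous-* (h i) (g j)))
        (homogeneous-* (g i) (h j))))
    D-homogeneous (plusˢ k l) g h = plusˢ (D-homogeneous k g h) (D-homogeneous l g h)
    D-homogeneous (respˢ e k) g h = respˢ (D-cong e) (D-homogeneous k g h)

-- The algebra of a quadratic map, and its polynomial inverse.

module Maps {c ℓ} (K : Commutativeℚ-Algebra c ℓ) (n : ℕ) where
  open Polynomials (Commutativeℚ-Algebra.commutativeRing K)
  open Substitution K
  module E = Derivative {n} {n}
  open Vectors (polyAlgebra K n) n using
      ( V; ≋-trans; ≋-sym; ι; solve; _:+_; _:*_; :-_; _:=_; zeroˡ; +-congˡ; *-congˡ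
      ; *-congʳ; sum-cong-≋; ∑-comm; *-distribˡ-sum; *-distribʳ-sum; reflexive; ≋-refl
      ; _⊞_; _⋆_ )
      renaming (con to :con)

  act : Matrix → V → V → V
  act M u v i = ∑ n (λ k → M i k [ u ] * v k)

  act-congʳ : ∀ M u {v w} → v ≋ w → act M u v ≋ act M u w
  act-congʳ M u p i = sum-cong-≋ {n} (λ k → *-congˡ (p k))

  act-identity : ∀ u v → act identityᴹ u v ≋ v
  act-identity u v i = ≈-trans
    (sum-cong-≋ {n} (λ k → *-congʳ (reflexive
      (≡.cong (λ b → (if b then 1# {n} else 0#) [ u ]) (⌊≟⌋-sym i k)))))
    (E.∑-δ u i v)

  act-*ᴹ : ∀ M M′ u v → act (M *ᴹ M′) u v ≋ act M u (act M′ u v)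
  act-*ᴹ M M′ u v i = ≈-trans
    (sum-cong-≋ {n} (λ j → ≈-trans (*-congʳ (reflexive (∑-[] n _ u))) (*-distribʳ-sum {n} _ _)))
    (≈-trans (∑-comm {n} {n} _)
    (sum-cong-≋ {n} (λ k → ≈-trans (sum-cong-≋ {n} (λ j → *-assoc _ _ _)) (≈-sym (*-distribˡ-sum {n} _ _)))))

  module _ (H : PolyMap n) (symmetric : Symmetric (J (X ⊖ H))) (quadratic : ∀ i → Homogeneous 2 (H i))
           (nil : (J H ^ᴹ 4) ≈ᴹ zeroᴹ) where

    J-symmetric : Symmetric (J H)
    -- The Jacobian of `X ⊖ H` is `identityᴹ` minus `J H`, and the identity matrix is symmetric.
    J-symmetric i j = ≈-trans (solve 2 (λ δ h → h := δ :+ :- (δ :+ :- h)) ≈-refl (identityᴹ i j) (J H i j))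
      (≈-trans (+-cong δ-symmetric (neg-cong (symmetric i j)))
        (solve 2 (λ δ h → δ :+ :- (δ :+ :- h) := h) ≈-refl (identityᴹ j i) (J H j i)))
      where
      δ-symmetric : identityᴹ i j ≈ identityᴹ j i
      δ-symmetric = reflexive (≡.cong (λ b → if b then 1# else 0#) (⌊≟⌋-sym i j))

    infixr 7 _·_
    _·_ : V → V → V
    (u · v) i = D (H i) u v

    -- Since `J H k i` is `∂ k (H i)`, the derivative is the action of the transpose of `J H`;
    -- symmetry removes the transpose.
    ·-act : ∀ u v → u · v ≋ act (J H) u v
    ·-act u v i = ≈-trans (E.D-∑ (H i) u v)
      (sum-cong-≋ {n} (λ k → *-congʳ ([]-cong (J-symmetric k i))))

    -- Each multiplication by the same `u` adds a factor `J H` evaluated at `u`, so four of them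
    -- meet the hypothesis on the fourth power.
    u·power : ∀ k u v {w} → w ≋ act (J H ^ᴹ k) u v → u · w ≋ act (J H ^ᴹ suc k) u v
    u·power k u v {w} p = ≋-trans (·-act u w)
      (≋-trans (act-congʳ (J H) u p) (≋-sym (act-*ᴹ (J H) (J H ^ᴹ k) u v)))

    nilAlgebra : NilAlgebra (polyAlgebra K n) n
    nilAlgebra = record
      { _·_       = _·_
      ; ·-cong    = λ p q i → E.D-congʳ (H i) p q
      ; ·-comm    = λ u v i → E.D-comm (quadratic i) u v
      ; ·-⊞       = λ u v w i → E.D-+ (H i) u v w
      ; ·-⋆       = λ u r v i → E.D-* (H i) u r v
      ; invariant = λ u v w → ≈-trans
          (sum-cong-≋ {n} (λ i → ≈-trans (*-congʳ (·-act u v i)) (*-distribʳ-sum {n} _ _)))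
          (≈-trans (∑-comm {n} {n} _) (sum-cong-≋ {n} (λ k → ≈-trans
            (sum-cong-≋ {n} (λ i → ≈-trans
              (*-congʳ (*-congʳ ([]-cong (J-symmetric i k))))
              (solve 3 (λ m v w → (m :* v) :* w := v :* (m :* w)) ≈-refl (J H k i [ u ]) (v k) (w i))))
            (≈-trans (≈-sym (*-distribˡ-sum {n} _ _)) (*-congˡ (≈-sym (·-act u w k)))))))
      ; nilpotent = λ u v → ≋-trans
          (u·power 3 u v (u·power 2 u v (u·power 1 u v (u·power 0 u v (≋-sym (act-identity u v))))))
          (λ i → E.∑-0 n (λ k → ≈-trans (*-congʳ ([]-cong (nil i k))) (zeroˡ (v k))))
      -- Pairing with row `i` of the identity matrix reads off `v i`; evaluating that row at `X`
      -- only fits it to `act-identity`.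
      ; nondegenerate = λ v h i → ≈-trans (≈-sym (act-identity X v i)) (h (λ k → identityᴹ i k [ X ]))
      }

    open Inverse nilAlgebra

    H≈½ : ∀ i u → H i [ u ] ≈ ι ½ * (u · u) i
    H≈½ i u = ≈-trans (solve 1 (λ h → h := :con ½ :* (h :+ h)) ≈-refl _)
      (*-congˡ (≈-sym (E.D-diagonal (quadratic i) u)))

    F : PolyMap n
    F = X ⊖ H

    F≋ : F ≋ X ⊞ ι -½ ⋆ (X · X)
    F≋ i = +-congˡ (≈-trans (neg-cong (≈-trans (reflexive (≡.sym ([]-var (H i)))) (H≈½ i X)))
      (solve 1 (λ a → :- (:con ½ :* a) := :con -½ :* a) ≈-refl _))

    F∘inverse : F ∘ᴾ inverse X ≋ X
    F∘inverse i = ≈-trans (+-congˡ (≈-trans (neg-cong (H≈½ i (inverse X)))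
      (solve 1 (λ a → :- (:con ½ :* a) := :con -½ :* a) ≈-refl _))) (inverse-right X i)

    -- The coefficients of `H` are constants, so substitution changes only the point and the
    -- direction of the derivative.
    ·-[] : ∀ {u v u′ v′ : V} (w : V) → (∀ i → u i [ w ] ≈ u′ i) → (∀ i → v i [ w ] ≈ v′ i) →
      ∀ i → (u · v) i [ w ] ≈ (u′ · v′) i
    ·-[] {u} {v} w p q i = ≈-trans (reflexive (D-[] (H i) u v w)) (E.D-congʳ (H i) p q)

    -- By `·-[]`, substituting `F` into `inverse X` gives `inverse F`; as `F` is x - ½ x · x at x =
    -- X, `inverse-left` applies.
    inverse∘F : inverse X ∘ᴾ F ≋ X
    inverse∘F i = ≈-trans (≈-trans
      (+-cong (+-cong (+-cong (+-congˡ (*-congˡ (x² i))) (*-congˡ (x³ i)))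
        (+-cong (*-congˡ (·-[] {X} {X · X · X} F ≋-refl x³ i)) (*-congˡ (x²x² i))))
        (*-congˡ (·-[] {X} {(X · X) · (X · X)} F ≋-refl x²x² i)))
      (inverse-cong F≋ i)) (inverse-left X i)
      where
      x²   = ·-[] {X} {X} {F} {F} F ≋-refl ≋-refl
      x³   = ·-[] {X} {X · X} {F} F ≋-refl x²
      x²x² = ·-[] {X · X} {X · X} F x² x²

    homogeneous-· : ∀ {d e u v} → (∀ i → Homogeneous d (u i)) → (∀ i → Homogeneous e (v i)) →
      ∀ i → Homogeneous (d ℕ.+ e) ((u · v) i)
    homogeneous-· g h i = E.D-homogeneous (quadratic i) g h

    Homogeneous⇒Degree≤ : ∀ {d e p} → d ≤ e → Homogeneous {n} d p → Degree≤ e p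
    Homogeneous⇒Degree≤ d≤e zeroˢ              = zeroˢ
    Homogeneous⇒Degree≤ d≤e (termˢ a ≡.refl)   = termˢ a d≤e
    Homogeneous⇒Degree≤ d≤e (plusˢ h k)        = plusˢ (Homogeneous⇒Degree≤ d≤e h) (Homogeneous⇒Degree≤ d≤e k)
    Homogeneous⇒Degree≤ d≤e (respˢ e h)        = respˢ e (Homogeneous⇒Degree≤ d≤e h)

    degree : ∀ i → Degree≤ 5 (inverse X i)
    degree i = plusˢ (plusˢ (plusˢ (plusˢ (bound {1} homogeneous-var) (bound {2} (scale x²)))
        (bound {3} (scale x³))) (plusˢ (bound {4} (scale x⁴)) (bound {4} (scale x²x²)))) (bound {5} (scale xx²x²))
      where
      bound : ∀ {d} {u : V} → (∀ i → Homogeneous d (u i)) → {True (d ℕ.≤? 5)} → Degree≤ 5 (u i)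
      bound h {t} = Homogeneous⇒Degree≤ (toWitness t) (h i)
      scale : ∀ {d r} {u : V} → (∀ i → Homogeneous d (u i)) → ∀ i → Homogeneous d ((ι r ⋆ u) i)
      scale h i = homogeneous-* (homogeneous-con _) (h i)
      x² = homogeneous-· {u = X} {X} homogeneous-var homogeneous-var
      x³ = homogeneous-· {u = X} {X · X} homogeneous-var x²
      x⁴ = homogeneous-· {u = X} {X · X · X} homogeneous-var x³
      x²x² = homogeneous-· {u = X · X} {X · X} x² x²
      xx²x² = homogeneous-· {u = X} {(X · X) · (X · X)} homogeneous-var x²x²

-- Convolution of power series and substitution into quadratic forms.

module Series {c ℓ} (K : Commutativeℚ-Algebra c ℓ) (n : ℕ) where
  open Polynomials (Commutativeℚ-Algebra.commutativeRing K)
  open Substitution K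
  open Vectors (polyAlgebra K n) n using
      ( solve; _:+_; _:*_; _:=_; zeroˡ; zeroʳ; +-identityʳ; +-congˡ; +-congʳ; *-congˡ
      ; *-congʳ; sum-cong-≋; ∑-distrib-+; *-distribˡ-sum; distribˡ )
      renaming (con to :con)

  -- Homogeneity is forgotten because the inductions below shift sequences by `∘ suc`, which breaks
  -- the match between index and degree.
  Sequence : Set _
  Sequence = ℕ → Poly n

  conv : Sequence → Sequence → Sequence
  conv S T d = ∑ (suc d) (λ k → S (toℕ k) * T (d ∸ toℕ k))

  conv-cong : ∀ {S S′ T T′} → (∀ d → S d ≈ S′ d) → (∀ d → T d ≈ T′ d) → ∀ d → conv S T d ≈ conv S′ T′ d
  conv-cong p q d = sum-cong-≋ {suc d} (λ k → *-cong (p (toℕ k)) (q (d ∸ toℕ k)))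

  conv-+ : ∀ S T U d → conv (λ k → S k + T k) U d ≈ conv S U d + conv T U d
  conv-+ S T U d = ≈-trans (sum-cong-≋ {suc d} (λ k → *-distribʳ (U (d ∸ toℕ k)) (S (toℕ k)) (T (toℕ k))))
    (∑-distrib-+ {suc d} (λ k → S (toℕ k) * U (d ∸ toℕ k)) (λ k → T (toℕ k) * U (d ∸ toℕ k)))

  conv-* : ∀ a S T d → conv (λ k → a * S k) T d ≈ a * conv S T d
  conv-* a S T d = ≈-trans (sum-cong-≋ {suc d} (λ k → *-assoc a (S (toℕ k)) (T (d ∸ toℕ k))))
    (≈-sym (*-distribˡ-sum {suc d} a (λ k → S (toℕ k) * T (d ∸ toℕ k))))

  -- Splitting off the first term of `conv S T` leaves a multiple of a shift of `T` and the
  -- convolution of a shift of `S`; induction on `d` handles the latter.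
  conv-assoc : ∀ S T U d → conv (conv S T) U d ≈ conv S (conv T U) d
  conv-assoc S T U zero    = +-congʳ (≈-trans (*-congʳ (+-identityʳ _))
    (≈-trans (*-assoc _ _ _) (*-congˡ (≈-sym (+-identityʳ _)))))
  conv-assoc S T U (suc d) = ≈-trans
    (+-cong (*-congʳ (+-identityʳ _)) (≈-trans (conv-+ (λ k → S 0 * T (suc k)) (conv (S ∘ suc) T) U d)
      (+-cong (conv-* (S 0) (T ∘ suc) U d) (conv-assoc (S ∘ suc) T U d))))
    (solve 5 (λ s t u v w → (s :* t) :* u :+ (s :* v :+ w) := s :* (t :* u :+ v) :+ w) ≈-refl
      (S 0) (T 0) (U (suc d)) (conv (T ∘ suc) U d) _)

  -- By definition `conv` splits off its first term; splitting off the last one as well yields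
  -- commutativity.
  conv-last : ∀ S T d → conv S T (suc d) ≈ conv S (T ∘ suc) d + S (suc d) * T 0
  conv-last S T zero    = ≈-trans (+-congˡ (+-identityʳ _)) (+-congʳ (≈-sym (+-identityʳ _)))
  conv-last S T (suc d) = ≈-trans (+-congˡ (conv-last (S ∘ suc) T d)) (≈-sym (+-assoc _ _ _))

  conv-comm : ∀ S T d → conv S T d ≈ conv T S d
  conv-comm S T zero    = +-congʳ (*-comm _ _)
  conv-comm S T (suc d) = ≈-trans (+-cong (*-comm _ _) (conv-comm (S ∘ suc) T d))
    (≈-trans (+-comm _ _) (≈-sym (conv-last T S d)))

  conv-con : ∀ a S d → conv (part (conˢ a)) S d ≈ con a * S d
  conv-con a S zero    = +-identityʳ _
  conv-con a S (suc d) = ≈-trans (+-congˡ (Derivative.∑-0 {n} {n} (suc d) (λ k → zeroˡ (S (d ∸ toℕ k))))) (+-identityʳ _)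

  part-0ˢ : ∀ d → part (conˢ {n} (CommutativeRing.0# (Commutativeℚ-Algebra.commutativeRing K))) d ≈ 0#
  part-0ˢ zero    = ≈-refl
  part-0ˢ (suc d) = ≈-refl

  module _ {m} (G : Vector (PowerSeries n) m) where

    -- Each clause is a law of the ring of power series. Homogeneity is closed under `_≈_`, so the
    -- case `respˢ` below relies on this.
    []ˢ-cong : ∀ {p q : Poly m} → p ≈ q → p [ G ]ˢ ≈ˢ q [ G ]ˢ
    []ˢ-cong ≈-refl              d = ≈-refl
    []ˢ-cong (≈-sym e)           d = ≈-sym ([]ˢ-cong e d)
    []ˢ-cong (≈-trans e e′)      d = ≈-trans ([]ˢ-cong e d) ([]ˢ-cong e′ d)
    []ˢ-cong (+-cong e e′)       d = +-cong ([]ˢ-cong e d) ([]ˢ-cong e′ d)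
    []ˢ-cong (*-cong e e′)       d = conv-cong ([]ˢ-cong e) ([]ˢ-cong e′) d
    []ˢ-cong (neg-cong e)        d = neg-cong ([]ˢ-cong e d)
    []ˢ-cong (+-assoc p q r)     d = +-assoc _ _ _
    []ˢ-cong (+-comm p q)        d = +-comm _ _
    []ˢ-cong (+-identityˡ p)     d = ≈-trans (+-congʳ (part-0ˢ d)) (+-identityˡ _)
    []ˢ-cong (+-inverseˡ p)      d = ≈-trans (+-inverseˡ _) (≈-sym (part-0ˢ d))
    []ˢ-cong (*-assoc p q r)     d = conv-assoc (part (p [ G ]ˢ)) (part (q [ G ]ˢ)) (part (r [ G ]ˢ)) d
    []ˢ-cong (*-comm p q)        d = conv-comm (part (p [ G ]ˢ)) (part (q [ G ]ˢ)) d
    []ˢ-cong (*-identityˡ p)     d = ≈-trans (conv-con _ (part (p [ G ]ˢ)) d) (*-identityˡ _)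
    []ˢ-cong (*-distribʳ p q r)  d = conv-+ (part (q [ G ]ˢ)) (part (r [ G ]ˢ)) (part (p [ G ]ˢ)) d
    []ˢ-cong (con-cong e)        zero    = con-cong e
    []ˢ-cong (con-cong e)        (suc d) = ≈-refl
    []ˢ-cong (con-+ a b)         zero    = con-+ a b
    []ˢ-cong (con-+ a b)         (suc d) = ≈-sym (+-identityˡ _)
    []ˢ-cong (con-* a b)         zero    = ≈-trans (con-* a b) (≈-sym (conv-con a (part (conˢ b)) 0))
    []ˢ-cong (con-* a b)         (suc d) = ≈-sym (≈-trans (conv-con a (part (conˢ b)) (suc d)) (zeroʳ _))

    parts : ℕ → Vector (Poly n) m
    parts d i = part (G i) d

    -- The degree `d` part of the polar form of a quadratic `p` with the series `G` in both
    -- arguments.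
    polarised : Poly m → Sequence
    polarised p d = ∑ (suc d) (λ k → D p (parts (toℕ k)) (parts (d ∸ toℕ k)))

    -- Euler's identity for series: a monomial contributes its two convolutions in opposite orders,
    -- which agree by `conv-comm`.
    quadratic-[]ˢ : ∀ {p : Poly m} → Homogeneous 2 p → ∀ d →
      part (p [ G ]ˢ) d + part (p [ G ]ˢ) d ≈ polarised p d
    quadratic-[]ˢ zeroˢ d = ≈-trans (+-cong (part-0ˢ d) (part-0ˢ d))
      (≈-trans (+-identityˡ _) (≈-sym (Derivative.∑-0 {n} {n} (suc d) (λ k → ≈-refl))))
    quadratic-[]ˢ (termˢ a {i ∷ j ∷ []} ≡.refl) d = ≈-trans (+-cong term term) (≈-sym polarised-term)
      where
      g = part (G i)
      h = part (G j)
      1ˢ : Sequence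
      1ˢ = part (1# [ G ]ˢ)
      term : part ((con a * ⟦ i ∷ j ∷ [] ⟧ᵐ) [ G ]ˢ) d ≈ con a * conv g h d
      term = ≈-trans (conv-con a (conv g (conv h 1ˢ)) d) (*-congˡ (conv-cong {g} (λ _ → ≈-refl)
        (λ e → ≈-trans (conv-comm h 1ˢ e) (≈-trans (conv-con _ h e) (*-identityˡ _))) d))
      polarised-term : polarised (con a * ⟦ i ∷ j ∷ [] ⟧ᵐ) d ≈ con a * conv g h d + con a * conv g h d
      polarised-term = ≈-trans
        (sum-cong-≋ {suc d} (λ k → ≈-trans
          (Derivative.D-term a i j (parts (toℕ k)) (parts (d ∸ toℕ k)))
          (*-congˡ (+-congʳ (*-comm (g (d ∸ toℕ k)) (h (toℕ k)))))))
        (≈-trans (≈-sym (*-distribˡ-sum {suc d} (con a) (λ k → h (toℕ k) * g (d ∸ toℕ k) + g (toℕ k) * h (d ∸ toℕ k))))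
        (≈-trans (*-congˡ (≈-trans
          (∑-distrib-+ {suc d} (λ k → h (toℕ k) * g (d ∸ toℕ k)) (λ k → g (toℕ k) * h (d ∸ toℕ k)))
          (+-congʳ (conv-comm h g d))))
        (distribˡ _ _ _)))
    quadratic-[]ˢ (plusˢ {p} {q} h k) d = ≈-trans
      (solve 2 (λ p q → (p :+ q) :+ (p :+ q) := (p :+ p) :+ (q :+ q)) ≈-refl _ _)
      (≈-trans (+-cong (quadratic-[]ˢ h d) (quadratic-[]ˢ k d)) (≈-sym
        (∑-distrib-+ {suc d} (λ k → D p (parts (toℕ k)) (parts (d ∸ toℕ k)))
          (λ k → D q (parts (toℕ k)) (parts (d ∸ toℕ k))))))
    quadratic-[]ˢ (respˢ {p} {q} e h) d = ≈-trans (≈-sym (+-cong ([]ˢ-cong e d) ([]ˢ-cong e d)))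
      (≈-trans (quadratic-[]ˢ h d) (sum-cong-≋ {suc d} (λ k → Derivative.D-cong {u = parts (toℕ k)} {parts (d ∸ toℕ k)} e)))

-- The homogeneous parts of the formal inverse.

module Uniqueness {κ ℓ} (K : Commutativeℚ-Algebra κ ℓ) (n : ℕ) where
  open Polynomials (Commutativeℚ-Algebra.commutativeRing K)
  open Substitution K
  open Maps K n using (nilAlgebra)
  open Series K n
  open Vectors (polyAlgebra K n) n using
      ( V; 0ⱽ; 0#-homo; ι; solve; _:+_; _:*_; :-_; _:=_; +-congˡ; *-congˡ; ≋-trans; _⋆_ )
      renaming (con to :con)

  module _ (H : PolyMap n) (symmetric : Symmetric (J (X ⊖ H))) (quadratic : ∀ i → Homogeneous 2 (H i))
           (nil : (J H ^ᴹ 4) ≈ᴹ zeroᴹ)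
           (G : Vector (PowerSeries n) n) (isInverse : IsFormalInverse (X ⊖ H) G) where
    open IsFormalInverse isInverse
    private
      L = nilAlgebra H symmetric quadratic nil
    open NilAlgebra L
    open NilAlgebraProperties L using (0̂; hat; ·-nullʳ; ·-nullˡ; ⋆-null; ⋆-nullˡ; ⊞-nullˡ; ⋆-·)
    open OneGenerator L
    open Inverse L

    g : ℕ → V
    g = parts G

    -- The degree `2 ℕ.+ d` part of G - H(G) = X; for such an index `varˢ` reduces to `0#`, and ½
    -- turns the doubled H(G) into H(G).
    recurrence : ∀ d i → g (2 ℕ.+ d) i ≈ ι ½ * polarised G (H i) (2 ℕ.+ d)
    recurrence d i = ≈-trans
      (solve 2 (λ g h → g := (g :+ :- h) :+ :con ½ :* (h :+ h)) ≈-refl (g (2 ℕ.+ d) i) (part (H i [ G ]ˢ) (2 ℕ.+ d)))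
      (≈-trans (+-cong (F∘G≈X i (2 ℕ.+ d)) (*-congˡ (quadratic-[]ˢ G (quadratic i) (2 ℕ.+ d)))) (+-identityˡ _))

    0#≈0 : 0# ≈ ι 0ℚ
    0#≈0 = ≈-sym 0#-homo

    g₀ : g 0 ≋ 0ⱽ
    g₀ = part₀
    g₁ : g 1 ≋ X
    g₁ = part₁

    -- `left` and `right` remove the end terms of `polarised`. These contain `g 0`, and are the ones
    -- in which the unknown part itself occurs, so the recurrence becomes explicit.
    left : ∀ {u v : V} → u ≋ 0ⱽ → u · v ≋ 0̂
    left p = hat (·-nullˡ p)

    right : ∀ {u v : V} → v ≋ 0ⱽ → u · v ≋ 0̂
    right p = hat (·-nullʳ p)

    g₂ : g 2 ≋ N₁ X
    g₂ i = ≈-trans (recurrence 0 i) (*-congˡ (≈-trans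
      (+-cong (left {v = g 2} g₀ i) (+-cong (·-cong g₁ g₁ i) (+-cong (right {g 2} g₀ i) 0#≈0)))
      (solve 1 (λ a → :con 0ℚ :+ (a :+ (:con 0ℚ :+ :con 0ℚ)) := a) ≈-refl _)))

    g₃ : g 3 ≋ N₂ X
    g₃ i = ≈-trans (recurrence 1 i) (*-congˡ (≈-trans
      (+-cong (left {v = g 3} g₀ i) (+-cong (g₁₂ i) (+-cong (≈-trans (·-comm (g 2) (g 1) i) (g₁₂ i))
        (+-cong (right {g 3} g₀ i) 0#≈0))))
      (solve 1 (λ a → :con 0ℚ :+ (:con ½ :* a :+ (:con ½ :* a :+ (:con 0ℚ :+ :con 0ℚ))) := a) ≈-refl _)))
      where
      g₁₂ : g 1 · g 2 ≋ ι ½ ⋆ b X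
      g₁₂ = ≋-trans (·-cong g₁ g₂) (·-⋆ X (ι ½) (X · X))

    g₄ : g 4 ≋ N₃ X
    g₄ i = ≈-trans (recurrence 2 i) (≈-trans (*-congˡ
      (+-cong (left {v = g 4} g₀ i) (+-cong (g₁₃ i) (+-cong (g₂₂ i)
        (+-cong (≈-trans (·-comm (g 3) (g 1) i) (g₁₃ i)) (+-cong (right {g 4} g₀ i) 0#≈0))))))
      (solve 2 (λ c d → :con ½ :* (:con 0ℚ :+ (:con ½ :* c :+ (:con ½ :* (:con ½ :* d) :+ (:con ½ :* c :+ (:con 0ℚ :+ :con 0ℚ)))))
        := :con ½ :* c :+ :con ⅛ :* d) ≈-refl _ _))
      where
      g₁₃ : g 1 · g 3 ≋ ι ½ ⋆ c X
      g₁₃ = ≋-trans (·-cong g₁ g₃) (·-⋆ X (ι ½) (b X))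
      g₂₂ : g 2 · g 2 ≋ ι ½ ⋆ ι ½ ⋆ d X
      g₂₂ = ≋-trans (·-cong g₂ g₂) (≋-trans (·-⋆ _ (ι ½) (a X)) (λ j → *-congˡ (⋆-· (a X) (ι ½) (a X) j)))

    -- In x N₃ and N₁ N₂ only the multiple of `x · d` survives, because `xc` and `ab` annihilate the
    -- rest.
    g₅ : g 5 ≋ N₄ X
    g₅ i = ≈-trans (recurrence 3 i) (≈-trans (*-congˡ
      (+-cong (left {v = g 5} g₀ i) (+-cong (g₁₄ i) (+-cong (g₂₃ i)
        (+-cong (≈-trans (·-comm (g 3) (g 2) i) (g₂₃ i)) (+-cong (≈-trans (·-comm (g 4) (g 1) i) (g₁₄ i))
          (+-cong (right {g 5} g₀ i) 0#≈0)))))))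
      (solve 1 (λ e → :con ½ :* (:con 0ℚ :+ (:con ⅛ :* e :+ (:con 0ℚ :+ (:con 0ℚ :+ (:con ⅛ :* e :+ (:con 0ℚ :+ :con 0ℚ))))))
        := :con ⅛ :* e) ≈-refl _))
      where
      g₁₄ : g 1 · g 4 ≋ ι ⅛ ⋆ e X
      g₁₄ = ≋-trans (·-cong g₁ g₄) (≋-trans (·-⊞ X (ι ½ ⋆ c X) (ι ⅛ ⋆ d X))
        (⊞-nullˡ (⋆-null (xc X)) (·-⋆ X (ι ⅛) (d X))))
      g₂₃ : g 2 · g 3 ≋ 0̂
      g₂₃ = ≋-trans (·-cong g₂ g₃) (hat (⋆-null (⋆-nullˡ (ab X))))

    unique : inverse X ≋ X ⊕ N G 1 ⊕ N G 2 ⊕ N G 3 ⊕ N G 4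
    unique i = ≈-sym (+-cong (+-cong (+-cong (+-congˡ (g₂ i)) (g₃ i)) (g₄ i)) (g₅ i))

theorem3p9 : ∀ {c ℓ} (K : Commutativeℚ-Algebra c ℓ) (n : ℕ) → 1 ≤ n →
    let open Polynomials (Commutativeℚ-Algebra.commutativeRing K) in
    (H : PolyMap n) →
    let F = X ⊖ H in
    Symmetric (J F) →
    (∀ i → Homogeneous 2 (H i)) →
    (J H ^ᴹ 4) ≈ᴹ zeroᴹ →
    Σ[ F⁻¹ ∈ PolyMap n ]
    ( IsInverse F F⁻¹
    × (∀ (G : Vector (PowerSeries n) n) → IsFormalInverse F G →
    F⁻¹ ≋ X ⊕ N G 1 ⊕ N G 2 ⊕ N G 3 ⊕ N G 4)
    × (∀ i → Degree≤ 5 (F⁻¹ i)) )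
theorem3p9 K n _ H symmetric quadratic nil =
  -- The closed form is taken at the vector `X` of variables, in the algebra attached to `H`.
  inverse X , (F∘inverse H symmetric quadratic nil , inverse∘F H symmetric quadratic nil) ,
  unique H symmetric quadratic nil , degree H symmetric quadratic nil
  where
  open Polynomials (Commutativeℚ-Algebra.commutativeRing K)
  open Maps K n
  open Uniqueness K n
  open Inverse (nilAlgebra H symmetric quadratic nil)
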